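{- For all integers $n\ge 0$, $$c\phi_{18}(6n+5)\equiv 0\pmod{8}.$$
   Context: For a positive integer $k$ and an integer $n\ge 0$, $c\phi_k(n)$ denotes the number of $k$-colored generalized Frobenius partitions of $n$ (Andrews): two-rowed arrays $\begin{pmatrix} a_1 & a_2 & \cdots & a_r\\ b_1 & b_2 & \cdots & b_r\end{pmatrix}$ (with $r\ge 0$) in which every entry is a non-negative integer carrying one of $k$ colors, no integer occurs twice in the same color in the same row, each row is arranged in non-increasing order (equal integers being ordered by a fixed order on colors, so that a row is just a set of $r$ colored non-negative integers), and $n=r+\sum_{j=1}^r(a_j+b_j)$ (colors do not contribute to the sum). Equivalently, $\sum_{n\ge0}c\phi_k(n)q^n$ is the coefficient of $z^0$ in $\prod_{j\ge 0}(1+zq^{j+1})^k(1+z^{ -1}q^{j})^k$. -}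

module Defs where

open import Data.Empty using (⊥)
open import Data.Fin as Fin using (Fin)
import Data.Fin.Properties as Fin
open import Data.List.Base
  using (List; []; _∷_; length; map; filter; upTo; allFin; cartesianProduct; cartesianProductWith)
open import Data.List.Membership.Propositional using (_∈_)
open import Data.List.Membership.Propositional.Properties
  using (∈-filter⁺; ∈-filter⁻; ∈-cartesianProduct⁺; ∈-cartesianProductWith⁺; ∈-cartesianProductWith⁻; ∈-upTo⁺; ∈-allFin)
open import Data.List.Properties using (∷-injective)
open import Data.List.Relation.Unary.All as All using (All; []; _∷_)
open import Data.List.Relation.Unary.AllPairs using ([]; _∷_)
open import Data.List.Relation.Unary.Any using (here; there)
open import Data.List.Relation.Unary.Linked using (Linked; linked?)
open import Data.List.Relation.Unary.Unique.Propositional using (Unique)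
import Data.List.Relation.Unary.Unique.Propositional.Properties as Unique
open import Data.Nat.Base using (ℕ; zero; suc; _+_; _≤_; _>_; z≤n; s≤s)
open import Data.Nat.ListAction using (sum)
open import Data.Nat.Properties
  using (_≟_; _>?_; ≤-refl; ≤-reflexive; ≤-trans; m≤m+n; m≤n+m)
open import Data.Product.Base using (_×_; _,_; proj₁; proj₂)
open import Data.Product.Relation.Binary.Lex.Strict using (×-Lex; ×-decidable)
open import Function.Base using (flip)
open import Function.Bundles using (_⇔_; mk⇔)
open import Relation.Binary.Core using (Rel)
open import Relation.Binary.Definitions using (Decidable)
open import Relation.Binary.PropositionalEquality using (_≡_; refl; sym; trans)
open import Relation.Nullary.Decidable using (Dec; map′; _×-dec_)
import Level

-- A non-negative integer together with one of k colors.
Colored : ℕ → Set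
Colored k = ℕ × Fin k

-- Equal integers are ordered by color, so this order is total; a row that
-- decreases strictly for it is non-increasing in its integers and never
-- contains the same integer twice in the same color.
_≻_ : ∀ {k} → Rel (Colored k) Level.zero
_≻_ = ×-Lex _≡_ _>_ Fin._>_

_≻?_ : ∀ {k} → Decidable (_≻_ {k})
_≻?_ = ×-decidable _≟_ _>?_ (flip Fin._<?_)

Row : ℕ → Set
Row k = List (Colored k)

rowSum : ∀ {k} → Row k → ℕ
rowSum a = sum (map proj₁ a)

Array : ℕ → Set
Array k = Row k × Row k

record IsFrobeniusPartition (k n : ℕ) (ab : Array k) : Set where
  constructor mkIsFrobeniusPartition
  private
    a = proj₁ ab
    b = proj₂ ab
  field
    top-decreasing    : Linked _≻_ a
    bottom-decreasing : Linked _≻_ b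
    equal-length      : length a ≡ length b
    weight            : n ≡ length a + (rowSum a + rowSum b)

open IsFrobeniusPartition

isFrobeniusPartition? : ∀ k n (ab : Array k) → Dec (IsFrobeniusPartition k n ab)
isFrobeniusPartition? k n (a , b) =
  map′ (λ (p , q , r , s) → mkIsFrobeniusPartition p q r s)
       (λ x → top-decreasing x , bottom-decreasing x , equal-length x , weight x)
       (linked? _≻?_ a ×-dec linked? _≻?_ b ×-dec
        length a ≟ length b ×-dec n ≟ length a + (rowSum a + rowSum b))

-- All lists of length at most m over a given alphabet.
words : {A : Set} → List A → ℕ → List (List A)
words xs zero    = [] ∷ []
words xs (suc m) = [] ∷ cartesianProductWith _∷_ xs (words xs m)

coloredUpTo : ∀ k → ℕ → List (Colored k)
coloredUpTo k n = cartesianProduct (upTo (suc n)) (allFin k)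

-- In a partition of n, the entries and the length of a row are at most n, so
-- searching among such rows loses nothing (see ∈-frobeniusPartitions).
frobeniusPartitions : ∀ k → ℕ → List (Array k)
frobeniusPartitions k n =
  filter (isFrobeniusPartition? k n) (cartesianProduct rows rows)
  where
  rows : List (Row k)
  rows = words (coloredUpTo k n) n

cφ : ℕ → ℕ → ℕ
cφ k n = length (frobeniusPartitions k n)

-- Together, the next two facts say that cφ k n is the number of arrays
-- satisfying IsFrobeniusPartition k n.

frobeniusPartitions-unique : ∀ k n → Unique (frobeniusPartitions k n)
frobeniusPartitions-unique k n =
  Unique.filter⁺ (isFrobeniusPartition? k n)
    (Unique.cartesianProduct⁺ rows-unique rows-unique)
  where
  words-unique : {A : Set} {xs : List A} → Unique xs → ∀ m → Unique (words xs m)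
  words-unique u zero    = [] ∷ []
  words-unique {xs = xs} u (suc m) =
    All.tabulate []∉ ∷ Unique.cartesianProductWith⁺ _∷_ ∷-injective u (words-unique u m)
    where
    []∉ : ∀ {w} → w ∈ cartesianProductWith _∷_ xs (words xs m) → [] ≡ w → ⊥
    []∉ w∈ []≡w with ∈-cartesianProductWith⁻ _∷_ xs (words xs m) w∈
    ... | _ , _ , _ , _ , w≡x∷v with trans []≡w w≡x∷v
    ... | ()

  rows-unique : Unique (words (coloredUpTo k n) n)
  rows-unique =
    words-unique (Unique.cartesianProduct⁺ (Unique.upTo⁺ (suc n)) (Unique.allFin⁺ k)) n

∈-frobeniusPartitions : ∀ k n (ab : Array k) →
  ab ∈ frobeniusPartitions k n ⇔ IsFrobeniusPartition k n ab
∈-frobeniusPartitions k n ab@(a , b) =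
  mk⇔ (λ ab∈ → proj₂ (∈-filter⁻ (isFrobeniusPartition? k n) {xs = cartesianProduct rows rows} ab∈))
      (λ p → ∈-filter⁺ (isFrobeniusPartition? k n)
               (∈-cartesianProduct⁺ (top∈ p) (bottom∈ p)) p)
  where
  rows : List (Row k)
  rows = words (coloredUpTo k n) n

  ∈-words : {A : Set} {xs : List A} {w : List A} → All (_∈ xs) w →
            ∀ {m} → length w ≤ m → w ∈ words xs m
  ∈-words []       {zero}  _       = here refl
  ∈-words []       {suc m} _       = here refl
  ∈-words (x ∷ xs) {suc m} (s≤s l) = there (∈-cartesianProductWith⁺ _∷_ x (∈-words xs l))

  entries∈ : (c : Row k) → rowSum c ≤ n → All (_∈ coloredUpTo k n) c
  entries∈ []            _ = []
  entries∈ ((x , i) ∷ c) s =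
    ∈-cartesianProduct⁺ (∈-upTo⁺ (s≤s (≤-trans (m≤m+n x _) s))) (∈-allFin i)
      ∷ entries∈ c (≤-trans (m≤n+m _ x) s)

  row∈ : (c : Row k) → rowSum c ≤ n → length c ≤ n → c ∈ rows
  row∈ c s l = ∈-words (entries∈ c s) l

  module _ (p : IsFrobeniusPartition k n ab) where
    weight≤ : length a + (rowSum a + rowSum b) ≤ n
    weight≤ = ≤-reflexive (sym (weight p))

    sums≤ : rowSum a + rowSum b ≤ n
    sums≤ = ≤-trans (m≤n+m _ (length a)) weight≤

    length≤ : length a ≤ n
    length≤ = ≤-trans (m≤m+n _ _) weight≤

    top∈ : a ∈ rows
    top∈ = row∈ a (≤-trans (m≤m+n _ _) sums≤) length≤

    bottom∈ : b ∈ rows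
    bottom∈ = row∈ b (≤-trans (m≤n+m _ (rowSum a)) sums≤)
                (≤-trans (≤-reflexive (sym (equal-length p))) length≤)

{-# OPTIONS --safe #-}
module Submission where

open import Defs
open import Algebra.Bundles using (CommutativeMonoid; CommutativeRing)
open import Algebra.Morphism.Structures using (module RingMorphisms)
open import Data.Empty using (⊥; ⊥-elim)
open import Data.Fin.Base as Fin using (Fin; opposite)
import Data.Fin.Properties as Fin
open import Data.Integer.Base as ℤ using (ℤ; +_; 0ℤ; 1ℤ)
import Data.Integer.Divisibility.Signed as ℤ
import Data.Integer.Properties as ℤ
import Data.Integer.Solver as ℤ-Solver
open import Data.List.Base using (List; []; _∷_; _++_; map; length; filter; tabulate; cartesianProduct)
open import Data.List.Membership.Propositional using (_∈_)
open import Data.List.Membership.Propositional.Properties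
  using ( ∈-++⁺ˡ; ∈-++⁺ʳ; ∈-++⁻; ∈-map⁺; ∈-map⁻; ∈-tabulate⁺; ∈-filter⁺; ∈-filter⁻
        ; ∈-cartesianProduct⁺; ∈-cartesianProduct⁻ )
open import Data.List.Membership.Propositional.Properties.WithK using (unique∧set⇒bag)
open import Data.List.Properties using (map-++; map-∘; length-tabulate; ∷-injectiveʳ)
open import Data.List.Relation.Binary.BagAndSetEquality using (∼bag⇒↭)
open import Data.List.Relation.Binary.Permutation.Propositional.Properties using (↭-length)
open import Data.List.Relation.Unary.All as All using (All; []; _∷_)
import Data.List.Relation.Unary.All.Properties as All
open import Data.List.Relation.Unary.AllPairs as AllPairs using (AllPairs; []; _∷_)
import Data.List.Relation.Unary.AllPairs.Properties as AllPairs
open import Data.List.Relation.Unary.Any using (here; there)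
open import Data.List.Relation.Unary.Linked using (Linked)
open import Data.List.Relation.Unary.Linked.Properties using (AllPairs⇒Linked; Linked⇒AllPairs)
open import Data.List.Relation.Unary.Unique.Propositional using (Unique)
import Data.List.Relation.Unary.Unique.Propositional.Properties as Unique
open import Data.Nat.Base as ℕ using (ℕ; zero; suc; z≤n; s≤s)
import Data.Nat.Divisibility as ℕ
import Data.Nat.DivMod as ℕ
import Data.Nat.Properties as ℕ
import Data.Nat.Solver as ℕ-Solver
open import Data.Product.Base using (_×_; _,_; proj₁; proj₂; ∃-syntax; swap)
open import Data.Product.Properties using (≡-dec)
open import Data.Sum.Base using (inj₁; inj₂)
open import Function.Base using (_∘_; id)
open import Function.Bundles using (mk⇔; Equivalence)
open import Level using (0ℓ)
open import Relation.Binary.PropositionalEquality as ≡ using (_≡_)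
import Relation.Binary.Reasoning.Setoid
open import Relation.Nullary.Decidable using (Dec; yes; no)

-- With q = xy, cφ₁₈(n) is the coefficient of xⁿyⁿ in F¹⁸, where
-- F = ∏_{j≥0} (1 + x qʲ)(1 + y qʲ).  By the Jacobi triple product F = U Θ with
-- U(q) = ∏ (1 - qʲ)⁻¹ and Θ(x,y) = Σ_r x^{r(r+1)/2} y^{r(r-1)/2}.  Since a ≡ b mod 2
-- implies a⁴ ≡ b⁴ mod 8, modulo 8
--   F¹⁸ ≡ U(q)² U(q²)⁸ Θ(x,y)² Θ(x⁴,y⁴)⁴.
-- The terms of the last factor have charge (exponent of x minus exponent of y)
-- divisible by 4, so on the diagonal Θ(x,y)² may be replaced by
-- Θ(x,-y) Θ(-x,y) = U(-q)⁻² U(q²) Θ(-x²,-y²), and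
-- (U(q)/U(-q))² ≡ 1 + 4 Σ_{l≥0} q^{(2l+1)²} = 1 + 4 q ψ(q⁸) mod 8, where
-- ψ(q) = Σ_k q^{k(k+1)/2}.  For odd n the summand 1 contributes nothing; the rest
-- is 4 times an expression needed modulo 2 only.  There U³ψ ≡ 1 (the triple
-- product at x = q, y = 1) leaves q ψ(q²), and exchanging x and y shows that the
-- theta factors contribute only their constant term 1.  Finally 1 + k(k+1) is
-- never 6m+5, since k(k+1) is 0 or 2 modulo 3.

-- The variables come from the product that defines cφ: put x = zq and y = 1/z. Then z⁰qⁿ is xⁿyⁿ,
-- negative powers disappear, and z ↦ 1/(zq) becomes the exchange of x and y. The obstacle is the
-- infinite products. All identities are proved in an arbitrary commutative ring with `q ^ N ≈ 0#`,
-- where sums and products cut off at N are exact: every omitted term is 0 and every omitted factor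
-- is 1. The instance is polynomials in x and y modulo total degree above 2n, which retains xⁿyⁿ.
-- Beyond the ring laws it only has to allow cancelling a factor 2. Trading Θ(x,y)² for Θ(x,-y)
-- Θ(-x,y) pays off because the latter leaves (U(q)/U(-q))² times a series in q², x² and y². For odd
-- n the leading 1 then meets only even exponents, and what remains already carries a factor 4, so
-- that only a parity is left to decide.

-- Finite sums and products over an initial range of indices.

module Range (M : CommutativeMonoid 0ℓ 0ℓ) where
  open CommutativeMonoid M
  open import Algebra.Properties.CommutativeSemigroup commutativeSemigroup using (interchange)

  ⨁ : ℕ → (ℕ → Carrier) → Carrier
  ⨁ zero    f = ε
  ⨁ (suc n) f = f 0 ∙ ⨁ n (f ∘ suc)

  ⨁-cong : ∀ n {f g} → (∀ i → f i ≈ g i) → ⨁ n f ≈ ⨁ n g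
  ⨁-cong zero    f≈g = refl
  ⨁-cong (suc n) f≈g = ∙-cong (f≈g 0) (⨁-cong n (f≈g ∘ suc))

  ⨁-distrib : ∀ n f g → ⨁ n (λ i → f i ∙ g i) ≈ ⨁ n f ∙ ⨁ n g
  ⨁-distrib zero    f g = sym (identityˡ ε)
  ⨁-distrib (suc n) f g = trans (∙-congˡ (⨁-distrib n (f ∘ suc) (g ∘ suc))) (interchange _ _ _ _)

  ⨁-ε : ∀ n {f} → (∀ i → f i ≈ ε) → ⨁ n f ≈ ε
  ⨁-ε zero    f≈ε = refl
  ⨁-ε (suc n) f≈ε = trans (∙-cong (f≈ε 0) (⨁-ε n (f≈ε ∘ suc))) (identityˡ ε)

  ⨁-last : ∀ n f → ⨁ (suc n) f ≈ ⨁ n f ∙ f n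
  ⨁-last zero    f = comm _ _
  ⨁-last (suc n) f = trans (∙-congˡ (⨁-last n (f ∘ suc))) (sym (assoc _ _ _))

  ⨁-truncate : ∀ n k {f} → (∀ i → n ℕ.≤ i → f i ≈ ε) → ⨁ (n ℕ.+ k) f ≈ ⨁ n f
  ⨁-truncate zero    k f≈ε = ⨁-ε k (λ i → f≈ε i z≤n)
  ⨁-truncate (suc n) k f≈ε = ∙-congˡ (⨁-truncate n k (λ i n≤i → f≈ε (suc i) (s≤s n≤i)))

  ⨁-pairs : ∀ n f → ⨁ (n ℕ.* 2) f ≈ ⨁ n (λ i → f (i ℕ.* 2) ∙ f (suc (i ℕ.* 2)))
  ⨁-pairs zero    f = refl
  ⨁-pairs (suc n) f = trans (sym (assoc _ _ _)) (∙-congˡ (⨁-pairs n (f ∘ suc ∘ suc)))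

module BigOperators (R : CommutativeRing 0ℓ 0ℓ) where
  open CommutativeRing R using (+-commutativeMonoid; *-commutativeMonoid)
  open Range +-commutativeMonoid public renaming
    ( ⨁ to ∑; ⨁-cong to ∑-cong; ⨁-distrib to ∑-distrib; ⨁-ε to ∑-0; ⨁-last to ∑-last
    ; ⨁-truncate to ∑-truncate )
  open Range *-commutativeMonoid public renaming
    ( ⨁ to ∏; ⨁-cong to ∏-cong; ⨁-distrib to ∏-distrib; ⨁-ε to ∏-1; ⨁-last to ∏-last
    ; ⨁-truncate to ∏-truncate; ⨁-pairs to ∏-pairs )

-- The Jacobi triple product over a nilpotent base.

module TripleProduct (R : CommutativeRing 0ℓ 0ℓ) where
  open CommutativeRing R
  open import Algebra.Properties.CommutativeSemiring.Exp commutativeSemiring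
  open import Algebra.Solver.Ring.NaturalCoefficients.Default commutativeSemiring
    using (solve; con; _:+_; _:*_; _:=_)
  open import Relation.Binary.Reasoning.Setoid setoid
  open BigOperators R

  *-∑ : ∀ n x f → x * ∑ n f ≈ ∑ n (λ i → x * f i)
  *-∑ zero    x f = zeroʳ x
  *-∑ (suc n) x f = trans (distribˡ x _ _) (+-congˡ (*-∑ n x (f ∘ suc)))

  sq : Carrier → Carrier
  sq a = a * a

  -- The finite q-Pochhammer symbol (-t; q)_n.
  poch : Carrier → Carrier → ℕ → Carrier
  poch q t n = ∏ n (λ j → 1# + t * q ^ j)

  -- q^(k(k-1)/2) t^k
  Z : Carrier → Carrier → ℕ → Carrier
  Z q t zero    = 1#
  Z q t (suc k) = t * q ^ k * Z q t k

  Z-cong : ∀ {q q′ t t′} → q ≈ q′ → t ≈ t′ → ∀ k → Z q t k ≈ Z q′ t′ k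
  Z-cong q≈ t≈ zero    = refl
  Z-cong q≈ t≈ (suc k) = *-cong (*-cong t≈ (^-congˡ k q≈)) (Z-cong q≈ t≈ k)

  Z-scale : ∀ q t k → Z q (q * t) k ≈ q ^ k * Z q t k
  Z-scale q t zero    = sym (*-identityˡ 1#)
  Z-scale q t (suc k) = trans (*-congˡ (Z-scale q t k))
    (solve 4 (λ q t p z → q :* t :* p :* (p :* z) := q :* p :* (t :* p :* z)) refl q t (q ^ k) (Z q t k))

  module Truncated (N : ℕ) where

    -- If `p ^ N` vanishes, this is the inverse of 1 - p, so that `u q k` and `U q` below stand for
    -- 1/(q; q)_k and 1/(q; q)_∞.
    geom : Carrier → Carrier
    geom p = ∑ N (p ^_)

    u : Carrier → ℕ → Carrier
    u q k = ∏ k (λ j → geom (q ^ suc j))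

    U : Carrier → Carrier
    U q = u q N

    -- For `x * y ≈ q`, `Z q x r` is x^(r(r+1)/2) y^(r(r-1)/2), the term of charge r, and `Z q y r`
    -- is the term of charge -r.
    θ : Carrier → Carrier → Carrier → Carrier
    θ q x y = 1# + ∑ N (λ r → Z q x (suc r) + Z q y (suc r))

    F : Carrier → Carrier → Carrier → Carrier
    F q x y = poch q x N * poch q y N

    geom-unfold : ∀ {p} → p ^ N ≈ 0# → geom p ≈ 1# + p * geom p
    geom-unfold {p} pN = begin
      ∑ N (p ^_)               ≈⟨ sym (+-identityʳ _) ⟩
      ∑ N (p ^_) + 0#          ≈⟨ +-congˡ (sym pN) ⟩
      ∑ N (p ^_) + p ^ N       ≈⟨ sym (∑-last N (p ^_)) ⟩
      1# + ∑ N (λ i → p * p ^ i) ≈⟨ +-congˡ (sym (*-∑ N p (p ^_))) ⟩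
      1# + p * geom p          ∎

    module Nilpotent (q : Carrier) (qN : q ^ N ≈ 0#) where

      q^≥N : ∀ k → N ℕ.≤ k → q ^ k ≈ 0#
      q^≥N k N≤k with k ℕ.∸ N | ℕ.m+[n∸m]≡n N≤k
      ... | j | ≡.refl = trans (^-homo-* q N j) (trans (*-congʳ qN) (zeroˡ _))

      [q^suc]^N : ∀ j → (q ^ suc j) ^ N ≈ 0#
      [q^suc]^N j = trans (^-assocʳ q (suc j) N) (q^≥N _ (ℕ.m≤m+n N (j ℕ.* N)))

      -- This is (1 - q^(k+1)) / (q; q)_(k+1) = 1/(q; q)_k, rearranged to avoid subtraction.
      u-suc : ∀ k → u q (suc k) ≈ u q k + q ^ suc k * u q (suc k)
      u-suc k = begin
        u q (suc k)                 ≈⟨ ∏-last k _ ⟩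
        u q k * g                   ≈⟨ *-congˡ (geom-unfold ([q^suc]^N k)) ⟩
        u q k * (1# + p * g)        ≈⟨ solve 3 (λ u p g → u :* (con 1 :+ p :* g) := u :+ p :* (u :* g)) refl (u q k) p g ⟩
        u q k + p * (u q k * g)     ≈⟨ +-congˡ (*-congˡ (sym (∏-last k _))) ⟩
        u q k + p * u q (suc k)     ∎
        where p = q ^ suc k
              g = geom (q ^ suc k)

      u-stable : ∀ j → u q (j ℕ.+ N) ≈ U q
      u-stable zero    = refl
      u-stable (suc j) = begin
        u q (suc (j ℕ.+ N))                     ≈⟨ u-suc (j ℕ.+ N) ⟩
        u q (j ℕ.+ N) + q ^ suc (j ℕ.+ N) * _   ≈⟨ +-congˡ (*-congʳ (q^≥N _ (ℕ.m≤n+m N (suc j)))) ⟩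
        u q (j ℕ.+ N) + 0# * _                  ≈⟨ +-congˡ (zeroˡ _) ⟩
        u q (j ℕ.+ N) + 0#                      ≈⟨ +-identityʳ _ ⟩
        u q (j ℕ.+ N)                           ≈⟨ u-stable j ⟩
        U q                                     ∎

      Z≥N : ∀ t k → N ℕ.≤ k → Z q t (suc k) ≈ 0#
      Z≥N t k N≤k = begin
        t * q ^ k * Z q t k  ≈⟨ *-congʳ (*-congˡ (q^≥N k N≤k)) ⟩
        t * 0# * Z q t k     ≈⟨ *-congʳ (zeroʳ t) ⟩
        0# * Z q t k         ≈⟨ zeroˡ _ ⟩
        0#                   ∎

      poch-stable : ∀ t k → poch q t (N ℕ.+ k) ≈ poch q t N
      poch-stable t k = ∏-truncate N k λ j N≤j → trans (+-congˡ (trans (*-congˡ (q^≥N j N≤j)) (zeroʳ t))) (+-identityʳ 1#)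

      -- Euler's series.  Its functional equation, iterated until q^N t = 0, turns it into
      -- the product; uniqueness of power series solutions is not needed.
      e : Carrier → Carrier
      e t = ∑ (suc N) (λ k → u q k * Z q t k)

      e-cong : ∀ {s t} → s ≈ t → e s ≈ e t
      e-cong s≈t = ∑-cong (suc N) (λ k → *-congˡ {u q k} (Z-cong (refl {q}) s≈t k))

      -- Compare the terms in t^(k+1): `e (q * t)` gives the weight q^(k+1) u(k+1), its multiple by
      -- t gives u(k), and `u-suc` adds them up to u(k+1). The shift by t pushes one term past the
      -- end of the range, and that term contains q^N.
      e-step : ∀ t → e t ≈ (1# + t) * e (q * t)
      e-step t = sym (begin
        (1# + t) * e (q * t)
          ≈⟨ solve 2 (λ t a → (con 1 :+ t) :* a := a :+ t :* a) refl t _ ⟩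
        e (q * t) + t * e (q * t)
          ≈⟨ +-congˡ (*-∑ (suc N) t (λ k → u q k * Z q (q * t) k)) ⟩
        e (q * t) + ∑ (suc N) (λ k → t * (u q k * Z q (q * t) k))
          ≈⟨ +-congˡ (trans (∑-last N (λ k → t * (u q k * Z q (q * t) k))) (trans (+-congˡ last≈0) (+-identityʳ _))) ⟩
        (u q 0 * 1# + ∑ N (λ k → u q (suc k) * Z q (q * t) (suc k))) + ∑ N (λ k → t * (u q k * Z q (q * t) k))
          ≈⟨ +-assoc _ _ _ ⟩
        u q 0 * 1# + (∑ N (λ k → u q (suc k) * Z q (q * t) (suc k)) + ∑ N (λ k → t * (u q k * Z q (q * t) k)))
          ≈⟨ +-congˡ (sym (∑-distrib N _ _)) ⟩
        u q 0 * 1# + ∑ N (λ k → u q (suc k) * Z q (q * t) (suc k) + t * (u q k * Z q (q * t) k))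
          ≈⟨ +-congˡ (∑-cong N term) ⟩
        e t ∎)
        where
        last≈0 : t * (u q N * Z q (q * t) N) ≈ 0#
        last≈0 = begin
          t * (u q N * Z q (q * t) N)       ≈⟨ *-congˡ (*-congˡ (Z-scale q t N)) ⟩
          t * (u q N * (q ^ N * Z q t N))   ≈⟨ *-congˡ (*-congˡ (*-congʳ qN)) ⟩
          t * (u q N * (0# * Z q t N))      ≈⟨ solve 3 (λ t u z → t :* (u :* (con 0 :* z)) := con 0) refl t _ _ ⟩
          0# ∎
        term : ∀ k → u q (suc k) * Z q (q * t) (suc k) + t * (u q k * Z q (q * t) k) ≈ u q (suc k) * Z q t (suc k)
        term k = begin
          u q (suc k) * Z q (q * t) (suc k) + t * (u q k * Z q (q * t) k)
            ≈⟨ +-cong (*-congˡ (Z-scale q t (suc k))) (*-congˡ (*-congˡ (Z-scale q t k))) ⟩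
          u q (suc k) * (q ^ suc k * (t * q ^ k * Z q t k)) + t * (u q k * (q ^ k * Z q t k))
            ≈⟨ solve 6 (λ u' p t r z u → u' :* (p :* (t :* r :* z)) :+ t :* (u :* (r :* z)) := (u :+ p :* u') :* (t :* r :* z))
                 refl (u q (suc k)) (q ^ suc k) t (q ^ k) (Z q t k) (u q k) ⟩
          (u q k + q ^ suc k * u q (suc k)) * (t * q ^ k * Z q t k)
            ≈⟨ *-congʳ (sym (u-suc k)) ⟩
          u q (suc k) * Z q t (suc k) ∎

      e-0 : e 0# ≈ 1#
      e-0 = begin
        1# * 1# + ∑ N (λ k → u q (suc k) * (0# * q ^ k * Z q 0# k))
          ≈⟨ +-cong (*-identityˡ 1#) (∑-0 N (λ k → solve 3 (λ a b c → a :* (con 0 :* b :* c) := con 0) refl _ _ _)) ⟩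
        1# + 0#  ≈⟨ +-identityʳ 1# ⟩
        1#       ∎

      e-iterate : ∀ n t → e t ≈ poch q t n * e (q ^ n * t)
      e-iterate zero    t = sym (trans (*-identityˡ _) (e-cong (*-identityˡ t)))
      e-iterate (suc n) t = begin
        e t
          ≈⟨ e-step t ⟩
        (1# + t) * e (q * t)
          ≈⟨ *-congˡ (e-iterate n (q * t)) ⟩
        (1# + t) * (poch q (q * t) n * e (q ^ n * (q * t)))
          ≈⟨ sym (*-assoc _ _ _) ⟩
        (1# + t) * poch q (q * t) n * e (q ^ n * (q * t))
          ≈⟨ *-cong (*-cong (+-congˡ (sym (*-identityʳ t)))
               (∏-cong n (λ j → +-congˡ (solve 3 (λ q t p → q :* t :* p := t :* (q :* p)) refl q t (q ^ j)))))
               (e-cong (solve 3 (λ q t p → p :* (q :* t) := q :* p :* t) refl q t (q ^ n))) ⟩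
        poch q t (suc n) * e (q ^ suc n * t) ∎

      euler : ∀ t → e t ≈ poch q t N
      euler t = begin
        e t                          ≈⟨ e-iterate N t ⟩
        poch q t N * e (q ^ N * t)   ≈⟨ *-congˡ (trans (e-cong (trans (*-congʳ qN) (zeroˡ t))) e-0) ⟩
        poch q t N * 1#              ≈⟨ *-identityʳ _ ⟩
        poch q t N                   ∎

      module _ (x y : Carrier) (xy≈q : x * y ≈ q) where

        -- Y M k is the term of charge M - k of the two-sided theta series; multiplying
        -- S M by 1 + x q^M raises all charges by one.
        Y : ℕ → ℕ → Carrier
        Y zero    k       = Z q y k
        Y (suc M) zero    = Z q x (suc M)
        Y (suc M) (suc k) = Y M k

        Y-0 : ∀ M → Y M 0 ≈ Z q x M
        Y-0 zero    = refl
        Y-0 (suc M) = refl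

        Y-diag : ∀ k M → Y (k ℕ.+ M) k ≈ Z q x M
        Y-diag zero    M = Y-0 M
        Y-diag (suc k) M = Y-diag k M

        Y-below : ∀ M k → Y M (M ℕ.+ k) ≈ Z q y k
        Y-below zero    k = refl
        Y-below (suc M) k = Y-below M k

        -- Multiplying the term of charge c by x q^c gives the term of charge c + 1; here c = M - k,
        -- and `q ^ k` makes up for the use of q^M. Only the passage between negative charges, in
        -- the second case, appeals directly to `xy≈q`.
        Y-step : ∀ M k → q ^ k * Y (suc M) k ≈ x * q ^ M * Y M k
        Y-step M zero = trans (*-identityˡ _) (*-congˡ (sym (Y-0 M)))
        Y-step zero (suc k) = begin
          q * q ^ k * Z q y k          ≈⟨ *-congʳ (*-congʳ (sym xy≈q)) ⟩
          x * y * q ^ k * Z q y k      ≈⟨ solve 4 (λ x y p z → x :* y :* p :* z := x :* con 1 :* (y :* p :* z)) refl x y (q ^ k) (Z q y k) ⟩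
          x * 1# * (y * q ^ k * Z q y k) ∎
        Y-step (suc M) (suc k) = begin
          q * q ^ k * Y (suc M) k      ≈⟨ *-assoc _ _ _ ⟩
          q * (q ^ k * Y (suc M) k)    ≈⟨ *-congˡ (Y-step M k) ⟩
          q * (x * q ^ M * Y M k)      ≈⟨ solve 4 (λ q x p z → q :* (x :* p :* z) := x :* (q :* p) :* z) refl q x (q ^ M) (Y M k) ⟩
          x * (q * q ^ M) * Y M k      ∎

        -- Euler's series `e y` at `M = 0`. For every M the sum runs down to charge -N, below which
        -- all terms vanish. At a fixed charge the weight is `u q k` with k growing along with M, so
        -- it tends to `U q`.
        S : ℕ → Carrier
        S M = ∑ (suc (M ℕ.+ N)) (λ k → u q k * Y M k)

        -- `u-suc` splits the weight of each term after the first: one part reassembles `S M`, the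
        -- other joins the first term in a sum of `q ^ k * u q k * Y (suc M) k`, which `Y-step`
        -- turns into x q^M times `S M`.
        S-step : ∀ M → S (suc M) ≈ S M * (1# + x * q ^ M)
        S-step M = begin
          1# * Y (suc M) 0 + ∑ K (λ k → u q (suc k) * Y M k)
            ≈⟨ +-congˡ (∑-cong K (λ k → trans (*-congʳ {Y M k} (u-suc k)) (distribʳ _ _ _))) ⟩
          1# * Y (suc M) 0 + ∑ K (λ k → u q k * Y M k + q ^ suc k * u q (suc k) * Y M k)
            ≈⟨ +-congˡ (∑-distrib K (λ k → u q k * Y M k) (λ k → q ^ suc k * u q (suc k) * Y M k)) ⟩
          1# * Y (suc M) 0 + (S M + ∑ K (λ k → q ^ suc k * u q (suc k) * Y M k))
            ≈⟨ solve 3 (λ a b c → con 1 :* a :+ (b :+ c) := b :+ (con 1 :* con 1 :* a :+ c)) refl _ _ _ ⟩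
          S M + ∑ (suc K) (λ k → q ^ k * u q k * Y (suc M) k)
            ≈⟨ +-congˡ (∑-cong (suc K) shift) ⟩
          S M + ∑ (suc K) (λ k → x * q ^ M * (u q k * Y M k))
            ≈⟨ +-congˡ (sym (*-∑ (suc K) (x * q ^ M) (λ k → u q k * Y M k))) ⟩
          S M + x * q ^ M * ∑ (suc K) (λ k → u q k * Y M k)
            ≈⟨ +-congˡ (*-congˡ (trans (∑-last K (λ k → u q k * Y M k)) (trans (+-congˡ last≈0) (+-identityʳ _)))) ⟩
          S M + x * q ^ M * S M
            ≈⟨ solve 2 (λ s p → s :+ p :* s := s :* (con 1 :+ p)) refl (S M) (x * q ^ M) ⟩
          S M * (1# + x * q ^ M) ∎
          where
          K = suc (M ℕ.+ N)
          shift : ∀ k → q ^ k * u q k * Y (suc M) k ≈ x * q ^ M * (u q k * Y M k)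
          shift k = begin
            q ^ k * u q k * Y (suc M) k    ≈⟨ solve 3 (λ p u y → p :* u :* y := u :* (p :* y)) refl _ _ _ ⟩
            u q k * (q ^ k * Y (suc M) k)  ≈⟨ *-congˡ (Y-step M k) ⟩
            u q k * (x * q ^ M * Y M k)    ≈⟨ solve 3 (λ u p y → u :* (p :* y) := p :* (u :* y)) refl _ _ _ ⟩
            x * q ^ M * (u q k * Y M k)    ∎
          last≈0 : u q K * Y M K ≈ 0#
          last≈0 = begin
            u q K * Y M K                  ≡⟨ ≡.cong (λ i → u q K * Y M i) (≡.sym (ℕ.+-suc M N)) ⟩
            u q K * Y M (M ℕ.+ suc N)      ≈⟨ *-congˡ (trans (Y-below M (suc N)) (Z≥N y N ℕ.≤-refl)) ⟩
            u q K * 0#                     ≈⟨ zeroʳ _ ⟩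
            0#                             ∎

        S-product : ∀ M → S M ≈ poch q x M * poch q y N
        S-product zero    = trans (euler y) (sym (*-identityˡ _))
        S-product (suc M) = begin
          S (suc M)                                      ≈⟨ S-step M ⟩
          S M * (1# + x * q ^ M)                         ≈⟨ *-congʳ (S-product M) ⟩
          poch q x M * poch q y N * (1# + x * q ^ M)     ≈⟨ solve 3 (λ a b c → a :* b :* c := a :* c :* b) refl _ _ _ ⟩
          poch q x M * (1# + x * q ^ M) * poch q y N     ≈⟨ *-congʳ (sym (∏-last M _)) ⟩
          poch q x (suc M) * poch q y N                  ∎

        W : ℕ → Carrier
        W M = ∑ (suc (M ℕ.+ N)) (Y M)

        W-split : ∀ M → W M ≈ ∑ M (λ r → Z q x (suc r)) + W 0
        W-split zero    = sym (+-identityˡ _)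
        W-split (suc M) = begin
          Z q x (suc M) + W M
            ≈⟨ +-congˡ (W-split M) ⟩
          Z q x (suc M) + (∑ M (λ r → Z q x (suc r)) + W 0)
            ≈⟨ solve 3 (λ a b c → a :+ (b :+ c) := b :+ a :+ c) refl _ _ _ ⟩
          ∑ M (λ r → Z q x (suc r)) + Z q x (suc M) + W 0
            ≈⟨ +-congʳ (sym (∑-last M _)) ⟩
          ∑ (suc M) (λ r → Z q x (suc r)) + W 0 ∎

        W-θ : W (N ℕ.+ N) ≈ θ q x y
        W-θ = begin
          W (N ℕ.+ N)
            ≈⟨ W-split (N ℕ.+ N) ⟩
          ∑ (N ℕ.+ N) (λ r → Z q x (suc r)) + (1# + ∑ N (λ r → Z q y (suc r)))
            ≈⟨ +-congʳ (∑-truncate N N (Z≥N x)) ⟩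
          ∑ N (λ r → Z q x (suc r)) + (1# + ∑ N (λ r → Z q y (suc r)))
            ≈⟨ solve 2 (λ a b → a :+ (con 1 :+ b) := con 1 :+ (a :+ b)) refl _ _ ⟩
          1# + (∑ N (λ r → Z q x (suc r)) + ∑ N (λ r → Z q y (suc r)))
            ≈⟨ +-congˡ (sym (∑-distrib N _ _)) ⟩
          θ q x y ∎

        -- At M = 2N every weight may be replaced by `U q`: for k ≥ N by `u-stable`, and for k < N
        -- because the term has charge 2N - k > N and is therefore 0.
        S-limit : S (N ℕ.+ N) ≈ U q * W (N ℕ.+ N)
        S-limit = trans (∑-cong (suc (N ℕ.+ N ℕ.+ N)) term) (sym (*-∑ (suc (N ℕ.+ N ℕ.+ N)) (U q) (Y (N ℕ.+ N))))
          where
          term : ∀ k → u q k * Y (N ℕ.+ N) k ≈ U q * Y (N ℕ.+ N) k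
          term k with N ℕ.≤? k
          ... | yes N≤k = *-congʳ (trans (reflexive (≡.cong (u q) (≡.sym (ℕ.m∸n+n≡m N≤k)))) (u-stable (k ℕ.∸ N)))
          ... | no  N≰k = trans (trans (*-congˡ Y≈0) (zeroʳ _)) (sym (trans (*-congˡ Y≈0) (zeroʳ _)))
            where
            k<N : k ℕ.< N
            k<N = ℕ.≰⇒> N≰k
            split : k ℕ.+ suc (N ℕ.+ (N ℕ.∸ suc k)) ≡.≡ N ℕ.+ N
            split = ≡.trans (ℕ.+-suc k _) (≡.trans (≡.cong (suc k ℕ.+_) (ℕ.+-comm N _))
              (≡.trans (≡.sym (ℕ.+-assoc (suc k) _ N)) (≡.cong (ℕ._+ N) (ℕ.m+[n∸m]≡n k<N))))
            Y≈0 : Y (N ℕ.+ N) k ≈ 0#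
            Y≈0 = trans (reflexive (≡.cong (λ M → Y M k) (≡.sym split)))
              (trans (Y-diag k _) (Z≥N x _ (ℕ.m≤m+n N _)))

        jacobiTripleProduct : F q x y ≈ U q * θ q x y
        jacobiTripleProduct = begin
          poch q x N * poch q y N           ≈⟨ *-congʳ (sym (poch-stable x N)) ⟩
          poch q x (N ℕ.+ N) * poch q y N   ≈⟨ sym (S-product (N ℕ.+ N)) ⟩
          S (N ℕ.+ N)                       ≈⟨ S-limit ⟩
          U q * W (N ℕ.+ N)                 ≈⟨ *-congˡ W-θ ⟩
          U q * θ q x y                     ∎

-- Congruences modulo 2, 4 and 8, and squaring.

module Congruence (R : CommutativeRing 0ℓ 0ℓ) where
  open CommutativeRing R
  open import Algebra.Properties.Ring ring using (-‿distribˡ-*; -‿distribʳ-*; -‿involutive)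
  open import Algebra.Properties.CommutativeSemiring.Exp commutativeSemiring
  open import Algebra.Solver.Ring.NaturalCoefficients.Default commutativeSemiring
    using (solve; con; _:+_; _:*_; _:=_)
  open import Relation.Binary.Reasoning.Setoid setoid
  open BigOperators R
  open TripleProduct R

  2# 4# 8# : Carrier
  2# = 1# + 1#
  4# = 2# * 2#
  8# = 2# * 4#

  infix 4 _≋_[_]
  -- The cofactor is explicit and no subtraction occurs, so a congruence can be certified by one
  -- identity of commutative semirings.
  _≋_[_] : Carrier → Carrier → Carrier → Set
  a ≋ b [ c ] = ∃[ h ] a ≈ b + c * h

  module _ {c : Carrier} where

    ≈⇒≋ : ∀ {a b} → a ≈ b → a ≋ b [ c ]
    ≈⇒≋ a≈b = 0# , trans a≈b (sym (trans (+-congˡ (zeroʳ c)) (+-identityʳ _)))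

    ≋-trans : ∀ {a b d} → a ≋ b [ c ] → b ≋ d [ c ] → a ≋ d [ c ]
    ≋-trans {a} {b} {d} (h , a≈) (k , b≈) = k + h , (begin
      a                    ≈⟨ a≈ ⟩
      b + c * h            ≈⟨ +-congʳ b≈ ⟩
      d + c * k + c * h    ≈⟨ solve 4 (λ d c k h → d :+ c :* k :+ c :* h := d :+ c :* (k :+ h)) refl d c k h ⟩
      d + c * (k + h)      ∎)

    ≋-sym : ∀ {a b} → a ≋ b [ c ] → b ≋ a [ c ]
    ≋-sym {a} {b} (h , a≈) = - h , sym (begin
      a + c * - h              ≈⟨ +-cong a≈ (sym (-‿distribʳ-* c h)) ⟩
      b + c * h + - (c * h)    ≈⟨ +-assoc _ _ _ ⟩
      b + (c * h + - (c * h))  ≈⟨ +-congˡ (-‿inverseʳ _) ⟩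
      b + 0#                   ≈⟨ +-identityʳ b ⟩
      b                        ∎)

    ≋-+ : ∀ {a b a′ b′} → a ≋ b [ c ] → a′ ≋ b′ [ c ] → a + a′ ≋ b + b′ [ c ]
    ≋-+ {b = b} {b′ = b′} (h , a≈) (k , a′≈) = h + k , trans (+-cong a≈ a′≈)
      (solve 5 (λ b b′ c h k → (b :+ c :* h) :+ (b′ :+ c :* k) := (b :+ b′) :+ c :* (h :+ k)) refl b b′ c h k)

    ≋-* : ∀ {a b a′ b′} → a ≋ b [ c ] → a′ ≋ b′ [ c ] → a * a′ ≋ b * b′ [ c ]
    ≋-* {b = b} {b′ = b′} (h , a≈) (k , a′≈) = h * b′ + b * k + c * h * k , trans (*-cong a≈ a′≈)
      (solve 5 (λ b b′ c h k → (b :+ c :* h) :* (b′ :+ c :* k) := b :* b′ :+ c :* (h :* b′ :+ b :* k :+ c :* h :* k)) refl b b′ c h k)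

    ≋-refl : ∀ {a} → a ≋ a [ c ]
    ≋-refl = ≈⇒≋ refl

    ≋-∑ : ∀ n {f g} → (∀ i → f i ≋ g i [ c ]) → ∑ n f ≋ ∑ n g [ c ]
    ≋-∑ zero    f≋g = ≋-refl
    ≋-∑ (suc n) f≋g = ≋-+ (f≋g 0) (≋-∑ n (f≋g ∘ suc))

    ≋-∏ : ∀ n {f g} → (∀ i → f i ≋ g i [ c ]) → ∏ n f ≋ ∏ n g [ c ]
    ≋-∏ zero    f≋g = ≋-refl
    ≋-∏ (suc n) f≋g = ≋-* (f≋g 0) (≋-∏ n (f≋g ∘ suc))

  infixr 2 _≋⟨_⟩_ _≈⟨_⟩≋_
  infix  3 _≋∎

  _≋⟨_⟩_ : ∀ a {b d c} → a ≋ b [ c ] → b ≋ d [ c ] → a ≋ d [ c ]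
  a ≋⟨ p ⟩ r = ≋-trans p r

  _≈⟨_⟩≋_ : ∀ a {b d c} → a ≈ b → b ≋ d [ c ] → a ≋ d [ c ]
  a ≈⟨ p ⟩≋ r = ≋-trans (≈⇒≋ p) r

  _≋∎ : ∀ a {c} → a ≋ a [ c ]
  a ≋∎ = ≋-refl

  4*-≋ : ∀ {a b} → a ≋ b [ 2# ] → 4# * a ≋ 4# * b [ 8# ]
  4*-≋ {b = b} (h , a≈) = h , trans (*-congˡ a≈)
    (solve 3 (λ b f h → let two = con 1 :+ con 1 in f :* (b :+ two :* h) := f :* b :+ two :* f :* h) refl b 4# h)

  sq-2⇒4 : ∀ {a b} → a ≋ b [ 2# ] → sq a ≋ sq b [ 4# ]
  sq-2⇒4 {b = b} (h , a≈) = b * h + h * h , trans (*-cong a≈ a≈)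
    (solve 2 (λ b h → let two = con 1 :+ con 1 in
      (b :+ two :* h) :* (b :+ two :* h) := b :* b :+ two :* two :* (b :* h :+ h :* h)) refl b h)

  sq-4⇒8 : ∀ {a b} → a ≋ b [ 4# ] → sq a ≋ sq b [ 8# ]
  sq-4⇒8 {b = b} (h , a≈) = b * h + 2# * (h * h) , trans (*-cong a≈ a≈)
    (solve 2 (λ b h → let two = con 1 :+ con 1 in
      (b :+ two :* two :* h) :* (b :+ two :* two :* h) := b :* b :+ two :* (two :* two) :* (b :* h :+ two :* (h :* h))) refl b h)

  sq-cong : ∀ {a b} → a ≈ b → sq a ≈ sq b
  sq-cong a≈b = *-cong a≈b a≈b

  sq-+ : ∀ a b → sq (a + b) ≋ sq a + sq b [ 2# ]
  sq-+ a b = a * b , solve 2 (λ a b → (a :+ b) :* (a :+ b) := a :* a :+ b :* b :+ (con 1 :+ con 1) :* (a :* b)) refl a b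

  sq-∑ : ∀ n f → sq (∑ n f) ≋ ∑ n (λ i → sq (f i)) [ 2# ]
  sq-∑ zero    f = ≈⇒≋ (zeroˡ 0#)
  sq-∑ (suc n) f = ≋-trans (sq-+ _ _) (≋-+ ≋-refl (sq-∑ n (f ∘ suc)))

  sq-* : ∀ a b → sq (a * b) ≈ sq a * sq b
  sq-* a b = solve 2 (λ a b → a :* b :* (a :* b) := a :* a :* (b :* b)) refl a b

  sq-∏ : ∀ n f → sq (∏ n f) ≈ ∏ n (λ i → sq (f i))
  sq-∏ n f = sym (∏-distrib n f f)

  sq-^ : ∀ a k → sq (a ^ k) ≈ sq a ^ k
  sq-^ a k = sym (^-distrib-* a a k)

  sq-neg : ∀ a → sq (- a) ≈ sq a
  sq-neg a = begin
    - a * - a    ≈⟨ sym (-‿distribˡ-* a (- a)) ⟩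
    - (a * - a)  ≈⟨ -‿cong (sym (-‿distribʳ-* a a)) ⟩
    - - (a * a)  ≈⟨ -‿involutive _ ⟩
    a * a        ∎

  Z-sq : ∀ q t k → sq (Z q t k) ≈ Z (sq q) (sq t) k
  Z-sq q t zero    = *-identityˡ 1#
  Z-sq q t (suc k) = trans (trans (sq-* _ _) (*-congʳ (sq-* _ _))) (*-cong (*-congˡ (sq-^ q k)) (Z-sq q t k))

  -- The terms at (i, j) and (j, i) with i ≠ j add up to a multiple of 2.
  ∑∑-diagonal : ∀ n (h : ℕ → ℕ → Carrier) → (∀ i j → h i j ≈ h j i) →
                ∑ n (λ i → ∑ n (h i)) ≋ ∑ n (λ i → h i i) [ 2# ]
  ∑∑-diagonal zero    h sym-h = ≋-refl
  ∑∑-diagonal (suc n) h sym-h =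
    (h 0 0 + row) + ∑ n (λ i → h (suc i) 0 + ∑ n (λ j → h (suc i) (suc j)))
      ≈⟨ +-congˡ (trans (∑-distrib n _ _) (+-congʳ (∑-cong n (λ i → sym-h (suc i) 0)))) ⟩≋
    (h 0 0 + row) + (row + ∑ n (λ i → ∑ n (λ j → h (suc i) (suc j))))
      ≋⟨ row , solve 3 (λ a r s → (a :+ r) :+ (r :+ s) := a :+ s :+ (con 1 :+ con 1) :* r) refl _ _ _ ⟩
    h 0 0 + ∑ n (λ i → ∑ n (λ j → h (suc i) (suc j)))
      ≋⟨ ≋-+ ≋-refl (∑∑-diagonal n (λ i j → h (suc i) (suc j)) (λ i j → sym-h (suc i) (suc j))) ⟩
    h 0 0 + ∑ n (λ i → h (suc i) (suc i)) ≋∎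
    where
    row = ∑ n (λ j → h 0 (suc j))

-- Identities and congruences for U, ψ and theta products.

module Theta (R : CommutativeRing 0ℓ 0ℓ) where
  open CommutativeRing R
  open import Algebra.Properties.Ring ring using (-‿distribˡ-*; -‿distribʳ-*; -‿involutive)
  open import Algebra.Properties.CommutativeSemiring.Exp commutativeSemiring
  open import Algebra.Solver.Ring.NaturalCoefficients.Default commutativeSemiring
    using (solve; con; _:+_; _:*_; _:=_)
  open import Relation.Binary.Reasoning.Setoid setoid
  open BigOperators R
  open TripleProduct R
  open Congruence R

  odd : ℕ → ℕ
  odd l = suc (l ℕ.* 2)

  neg-^-even : ∀ q l → (- q) ^ (l ℕ.* 2) ≈ q ^ (l ℕ.* 2)
  neg-^-even q zero    = refl
  neg-^-even q (suc l) = begin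
    - q * (- q * (- q) ^ (l ℕ.* 2))  ≈⟨ sym (*-assoc _ _ _) ⟩
    sq (- q) * (- q) ^ (l ℕ.* 2)     ≈⟨ *-cong (sq-neg q) (neg-^-even q l) ⟩
    sq q * q ^ (l ℕ.* 2)             ≈⟨ *-assoc _ _ _ ⟩
    q * (q * q ^ (l ℕ.* 2))          ∎

  neg-^-odd : ∀ q l → (- q) ^ odd l ≈ - (q ^ odd l)
  neg-^-odd q l = trans (*-congˡ (neg-^-even q l)) (sym (-‿distribˡ-* _ _))

  module HalfTruncated (M : ℕ) where

    -- An even length serves three ends: `(- q) ^ N` equals `q ^ N`, the factors of a product pair
    -- off into odd and even exponents, and an index i ≥ M has `odd i` above N.
    N : ℕ
    N = M ℕ.* 2

    N≡M+M : N ≡.≡ M ℕ.+ M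
    N≡M+M = ≡.trans (ℕ.*-comm M 2) (≡.cong (M ℕ.+_) (ℕ.+-identityʳ M))

    open Truncated N public

    E : Carrier → Carrier
    E q = ∏ N (λ j → 1# + - (q ^ suc j))

    -- `Z q q k` is q^(k(k+1)/2).
    ψ : Carrier → Carrier
    ψ q = ∑ N (Z q q)

    geom-cong : ∀ {p r} → p ≈ r → geom p ≈ geom r
    geom-cong p≈r = ∑-cong N (λ i → ^-congˡ i p≈r)

    geom-sq : ∀ p → sq (geom p) ≋ geom (sq p) [ 2# ]
    geom-sq p = ≋-trans (sq-∑ N (p ^_)) (≈⇒≋ (∑-cong N (sq-^ p)))

    U-sq : ∀ q → sq (U q) ≋ U (sq q) [ 2# ]
    U-sq q =
      sq (U q)                          ≈⟨ sq-∏ N _ ⟩≋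
      ∏ N (λ j → sq (geom (q ^ suc j))) ≋⟨ ≋-∏ N (λ j → geom-sq (q ^ suc j)) ⟩
      ∏ N (λ j → geom (sq (q ^ suc j))) ≈⟨ ∏-cong N (λ j → geom-cong (sq-^ q (suc j))) ⟩≋
      U (sq q)                          ≋∎

    θ-sq : ∀ q x y → sq (θ q x y) ≋ θ (sq q) (sq x) (sq y) [ 2# ]
    θ-sq q x y =
      sq (θ q x y)
        ≋⟨ sq-+ _ _ ⟩
      sq 1# + sq (∑ N (λ r → Z q x (suc r) + Z q y (suc r)))
        ≋⟨ ≋-+ (≈⇒≋ (*-identityˡ 1#)) (sq-∑ N _) ⟩
      1# + ∑ N (λ r → sq (Z q x (suc r) + Z q y (suc r)))
        ≋⟨ ≋-+ ≋-refl (≋-∑ N (λ r → ≋-trans (sq-+ _ _) (≈⇒≋ (+-cong (Z-sq q x (suc r)) (Z-sq q y (suc r)))))) ⟩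
      θ (sq q) (sq x) (sq y) ≋∎

    ψ-sq : ∀ q → sq (ψ q) ≋ ψ (sq q) [ 2# ]
    ψ-sq q = ≋-trans (sq-∑ N (Z q q)) (≈⇒≋ (∑-cong N (Z-sq q q)))

    geom-inverse : ∀ {p} → p ^ N ≈ 0# → geom p * (1# + - p) ≈ 1#
    geom-inverse {p} pN = begin
      geom p * (1# + - p)              ≈⟨ solve 2 (λ g m → g :* (con 1 :+ m) := g :+ m :* g) refl (geom p) (- p) ⟩
      geom p + - p * geom p            ≈⟨ +-cong (geom-unfold pN) (sym (-‿distribˡ-* p (geom p))) ⟩
      1# + p * geom p + - (p * geom p) ≈⟨ +-assoc _ _ _ ⟩
      1# + (p * geom p + - (p * geom p)) ≈⟨ +-congˡ (-‿inverseʳ _) ⟩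
      1# + 0#                          ≈⟨ +-identityʳ 1# ⟩
      1#                               ∎

    sq-nil : ∀ {q} → q ^ N ≈ 0# → sq q ^ N ≈ 0#
    sq-nil {q} qN = trans (sym (sq-^ q N)) (trans (*-congʳ qN) (zeroˡ _))

    neg-nil : ∀ {q} → q ^ N ≈ 0# → (- q) ^ N ≈ 0#
    neg-nil {q} qN = trans (neg-^-even q M) qN

    module Nil (q : Carrier) (qN : q ^ N ≈ 0#) where
      open Nilpotent q qN public

      U*E : U q * E q ≈ 1#
      U*E = trans (sym (∏-distrib N _ _)) (∏-1 N (λ j → geom-inverse ([q^suc]^N j)))

    poch-neg : ∀ q t → poch (- q) t N * poch (- q) (- t) N ≈ poch (sq q) (- sq t) N
    poch-neg q t = trans (sym (∏-distrib N _ _)) (∏-cong N factor)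
      where
      factor : ∀ j → (1# + t * (- q) ^ j) * (1# + - t * (- q) ^ j) ≈ 1# + - sq t * sq q ^ j
      factor j = begin
        (1# + t * p) * (1# + - t * p)
          ≈⟨ solve 3 (λ t m p → (con 1 :+ t :* p) :* (con 1 :+ m :* p) := con 1 :+ (t :+ m) :* p :+ (m :* t) :* (p :* p)) refl t (- t) p ⟩
        1# + (t + - t) * p + - t * t * sq p
          ≈⟨ +-cong (+-congˡ (trans (*-congʳ (-‿inverseʳ t)) (zeroˡ p))) (*-cong (sym (-‿distribˡ-* t t)) p²) ⟩
        1# + 0# + - sq t * sq q ^ j
          ≈⟨ +-congʳ (+-identityʳ 1#) ⟩
        1# + - sq t * sq q ^ j ∎
        where
        p = (- q) ^ j
        p² : sq p ≈ sq q ^ j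
        p² = trans (sq-^ (- q) j) (^-congˡ j (sq-neg q))

    module _ (q x y : Carrier) (xy≈q : x * y ≈ q) (qN : q ^ N ≈ 0#) where
      private
        module -q = Nil (- q) (neg-nil qN)
        module q² = Nil (sq q) (sq-nil qN)

      θ-solve : ∀ s t → s * t ≈ - q → θ (- q) s t ≈ E (- q) * F (- q) s t
      θ-solve s t st = begin
        θ (- q) s t                             ≈⟨ sym (*-identityˡ _) ⟩
        1# * θ (- q) s t                        ≈⟨ *-congʳ (sym -q.U*E) ⟩
        U (- q) * E (- q) * θ (- q) s t         ≈⟨ solve 3 (λ u e t → u :* e :* t := e :* (u :* t)) refl _ _ _ ⟩
        E (- q) * (U (- q) * θ (- q) s t)       ≈⟨ *-congˡ (sym (-q.jacobiTripleProduct s t st)) ⟩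
        E (- q) * F (- q) s t                   ∎

      -- Both theta series have base -q, since x · (-y) = (-x) · y = -q, and the triple product
      -- turns each into a product. Regrouped as x with -x and y with -y, these merge by `poch-neg`
      -- into products of base q², where the triple product is used backwards with the arguments -x²
      -- and -y².
      θ-neg-product : θ (- q) x (- y) * θ (- q) (- x) y ≈
                      sq (E (- q)) * (U (sq q) * θ (sq q) (- sq x) (- sq y))
      θ-neg-product = begin
        θ (- q) x (- y) * θ (- q) (- x) y
          ≈⟨ *-cong (θ-solve x (- y) (trans (sym (-‿distribʳ-* x y)) (-‿cong xy≈q)))
                    (θ-solve (- x) y (trans (sym (-‿distribˡ-* x y)) (-‿cong xy≈q))) ⟩
        (e * (poch (- q) x N * poch (- q) (- y) N)) * (e * (poch (- q) (- x) N * poch (- q) y N))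
          ≈⟨ solve 5 (λ e a b c d → (e :* (a :* b)) :* (e :* (c :* d)) := e :* e :* ((a :* c) :* (d :* b))) refl _ _ _ _ _ ⟩
        sq e * ((poch (- q) x N * poch (- q) (- x) N) * (poch (- q) y N * poch (- q) (- y) N))
          ≈⟨ *-congˡ (*-cong (poch-neg q x) (poch-neg q y)) ⟩
        sq e * F (sq q) (- sq x) (- sq y)
          ≈⟨ *-congˡ (q².jacobiTripleProduct (- sq x) (- sq y) product) ⟩
        sq e * (U (sq q) * θ (sq q) (- sq x) (- sq y)) ∎
        where
        e = E (- q)
        product : - sq x * - sq y ≈ sq q
        product = begin
          - sq x * - sq y    ≈⟨ sym (-‿distribˡ-* _ _) ⟩
          - (sq x * - sq y)  ≈⟨ -‿cong (sym (-‿distribʳ-* _ _)) ⟩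
          - - (sq x * sq y)  ≈⟨ -‿involutive _ ⟩
          sq x * sq y        ≈⟨ sym (sq-* x y) ⟩
          sq (x * y)         ≈⟨ sq-cong xy≈q ⟩
          sq q               ∎

    module _ (q : Carrier) (qN : q ^ N ≈ 0#) where
      open Nil q qN

      -- (1 + p)/(1 - p) = 1 + 2 p/(1 - p), whose square is 1 + 4 p/(1 - p)^2.
      sq-ratio : ∀ {p} → p ^ N ≈ 0# → sq (geom p * (1# + p)) ≈ 1# + 4# * (p * sq (geom p))
      sq-ratio {p} pN = begin
        sq (geom p * (1# + p))
          ≈⟨ sq-cong (solve 2 (λ g p → g :* (con 1 :+ p) := g :+ p :* g) refl (geom p) p) ⟩
        sq (geom p + w)
          ≈⟨ sq-cong (+-congʳ (geom-unfold pN)) ⟩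
        sq (1# + w + w)
          ≈⟨ solve 1 (λ w → let two = con 1 :+ con 1 in
               (con 1 :+ w :+ w) :* (con 1 :+ w :+ w) := con 1 :+ two :* two :* (w :* (con 1 :+ w))) refl w ⟩
        1# + 4# * (w * (1# + w))
          ≈⟨ +-congˡ (*-congˡ (*-congˡ (sym (geom-unfold pN)))) ⟩
        1# + 4# * (w * geom p)
          ≈⟨ +-congˡ (*-congˡ (*-assoc _ _ _)) ⟩
        1# + 4# * (p * sq (geom p)) ∎
        where w = p * geom p

      -- The cross terms carry a factor 16.
      ∏-1+4 : ∀ n v → ∏ n (λ l → 1# + 4# * v l) ≋ 1# + 4# * ∑ n v [ 8# ]
      ∏-1+4 zero    v = ≈⇒≋ (sym (trans (+-congˡ (zeroʳ 4#)) (+-identityʳ 1#)))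
      ∏-1+4 (suc n) v = ≋-trans (≋-* ≋-refl (∏-1+4 n (v ∘ suc)))
        (2# * (v 0 * s) , solve 2 (λ v s → let two = con 1 :+ con 1 in
          (con 1 :+ two :* two :* v) :* (con 1 :+ two :* two :* s) :=
          con 1 :+ two :* two :* (v :+ s) :+ two :* (two :* two) :* (two :* (v :* s))) refl (v 0) s)
        where s = ∑ n (v ∘ suc)

      -- Modulo 2, p/(1 - p)² is p/(1 - p²), the sum of the odd powers of p. With p = q^m for odd m
      -- this gives a symmetric double sum of q^(mm') over odd m and m', of which only the diagonal
      -- survives. In other words, an odd number has an odd number of divisors only if it is a
      -- square.
      lambert : ∑ M (λ l → q ^ odd l * sq (geom (q ^ odd l))) ≋ ∑ M (λ l → q ^ (odd l ℕ.* odd l)) [ 2# ]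
      lambert =
        ∑ M (λ l → q ^ odd l * sq (geom (q ^ odd l)))
          ≋⟨ ≋-∑ M (λ l → ≋-* ≋-refl (geom-sq (q ^ odd l))) ⟩
        ∑ M (λ l → q ^ odd l * geom (sq (q ^ odd l)))
          ≈⟨ ∑-cong M (λ l → trans (*-∑ N _ _) (∑-cong N (term l))) ⟩≋
        ∑ M (λ l → ∑ N (λ i → q ^ (odd l ℕ.* odd i)))
          -- Cutting the inner range down to `M` loses only exponents of at least `N`, and makes the
          -- double sum square.
          ≈⟨ ∑-cong M (λ l → trans (reflexive (≡.cong (λ n → ∑ n (λ i → q ^ (odd l ℕ.* odd i))) N≡M+M))
               (∑-truncate M M (λ i M≤i → q^≥N _ (bound l i M≤i)))) ⟩≋
        ∑ M (λ l → ∑ M (λ i → q ^ (odd l ℕ.* odd i)))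
          ≋⟨ ∑∑-diagonal M (λ l i → q ^ (odd l ℕ.* odd i)) (λ l i → ^-congʳ q (ℕ.*-comm (odd l) (odd i))) ⟩
        ∑ M (λ l → q ^ (odd l ℕ.* odd l)) ≋∎
        where
        term : ∀ l i → q ^ odd l * sq (q ^ odd l) ^ i ≈ q ^ (odd l ℕ.* odd i)
        term l i = begin
          p * sq p ^ i       ≈⟨ *-congˡ (sym (sq-^ p i)) ⟩
          p * sq (p ^ i)     ≈⟨ *-congˡ (sym (^-homo-* p i i)) ⟩
          p ^ suc (i ℕ.+ i)  ≡⟨ ≡.cong (λ n → p ^ suc n) (≡.sym (≡.trans (ℕ.*-comm i 2) (≡.cong (i ℕ.+_) (ℕ.+-identityʳ i)))) ⟩
          p ^ odd i          ≈⟨ ^-assocʳ q (odd l) (odd i) ⟩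
          q ^ (odd l ℕ.* odd i) ∎
          where p = q ^ odd l
        bound : ∀ l i → M ℕ.≤ i → N ℕ.≤ odd l ℕ.* odd i
        bound l i M≤i = ℕ.≤-trans (ℕ.m≤n⇒m≤1+n (ℕ.*-monoˡ-≤ 2 M≤i)) (ℕ.m≤m+n (odd i) _)

      -- The factors are (1 - (-q)^m)/(1 - q^m). They equal 1 for even m and (1 + q^m)/(1 - q^m) for
      -- odd m, where `sq-ratio` gives the square.
      sq-U*E : sq (U q * E (- q)) ≋ 1# + 4# * ∑ M (λ l → q ^ (odd l ℕ.* odd l)) [ 8# ]
      sq-U*E =
        sq (U q * E (- q))
          ≈⟨ trans (sq-cong (sym (∏-distrib N _ _))) (sq-∏ N _) ⟩≋
        ∏ N (λ j → sq (geom (q ^ suc j) * (1# + - ((- q) ^ suc j))))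
          ≈⟨ ∏-pairs M _ ⟩≋
        ∏ M (λ l → sq (geom (q ^ odd l) * (1# + - ((- q) ^ odd l))) *
                   sq (geom (q ^ (suc l ℕ.* 2)) * (1# + - ((- q) ^ (suc l ℕ.* 2)))))
          ≈⟨ ∏-cong M (λ l → trans (*-cong (odd-factor l) (even-factor l)) (*-identityʳ _)) ⟩≋
        ∏ M (λ l → 1# + 4# * (q ^ odd l * sq (geom (q ^ odd l))))
          ≋⟨ ∏-1+4 M _ ⟩
        1# + 4# * ∑ M (λ l → q ^ odd l * sq (geom (q ^ odd l)))
          ≋⟨ ≋-+ ≋-refl (4*-≋ lambert) ⟩
        1# + 4# * ∑ M (λ l → q ^ (odd l ℕ.* odd l)) ≋∎
        where
        odd-factor : ∀ l → sq (geom (q ^ odd l) * (1# + - ((- q) ^ odd l))) ≈ 1# + 4# * (q ^ odd l * sq (geom (q ^ odd l)))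
        odd-factor l = trans (sq-cong (*-congˡ (+-congˡ (trans (-‿cong (neg-^-odd q l)) (-‿involutive _)))))
          (sq-ratio ([q^suc]^N (l ℕ.* 2)))
        even-factor : ∀ l → sq (geom (q ^ (suc l ℕ.* 2)) * (1# + - ((- q) ^ (suc l ℕ.* 2)))) ≈ 1#
        even-factor l = trans (sq-cong (trans (*-congˡ (+-congˡ (-‿cong (neg-^-even q (suc l)))))
          (geom-inverse ([q^suc]^N (suc (l ℕ.* 2)))))) (*-identityˡ 1#)

      -- (2 l + 1)^2 = 1 + 8 l (l + 1) / 2
      q^odd² : ∀ l → q ^ (odd l ℕ.* odd l) ≈ q * Z (sq (sq (sq q))) (sq (sq (sq q))) l
      q^odd² zero    = refl
      q^odd² (suc l) = begin
        q ^ (odd (suc l) ℕ.* odd (suc l))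
          ≡⟨ ≡.cong (q ^_) (ℕ-Solver.+-*-Solver.solve 1 (λ l → (c 3 ⊕ l ⊗ c 2) ⊗ (c 3 ⊕ l ⊗ c 2) ⊜ c 8 ⊕ l ⊗ c 8 ⊕ (c 1 ⊕ l ⊗ c 2) ⊗ (c 1 ⊕ l ⊗ c 2)) ≡.refl l) ⟩
        q ^ (8 ℕ.+ l ℕ.* 8 ℕ.+ odd l ℕ.* odd l)
          ≈⟨ trans (^-homo-* q (8 ℕ.+ l ℕ.* 8) _) (*-congʳ (^-homo-* q 8 (l ℕ.* 8))) ⟩
        q ^ 8 * q ^ (l ℕ.* 8) * q ^ (odd l ℕ.* odd l)
          ≈⟨ *-cong (*-cong q⁸ (trans (trans (^-congʳ q (ℕ.*-comm l 8)) (sym (^-assocʳ q 8 l))) (^-congˡ l q⁸))) (q^odd² l) ⟩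
        p * p ^ l * (q * Z p p l)
          ≈⟨ solve 3 (λ a q z → a :* (q :* z) := q :* (a :* z)) refl _ _ _ ⟩
        q * Z p p (suc l) ∎
        where
        open ℕ-Solver.+-*-Solver using () renaming (con to c; _:+_ to _⊕_; _:*_ to _⊗_; _:=_ to _⊜_)
        p = sq (sq (sq q))
        q⁸ : q ^ 8 ≈ p
        q⁸ = solve 1 (λ q → let s = λ a → a :* a in q :* (q :* (q :* (q :* (q :* (q :* (q :* (q :* con 1))))))) := s (s (s q))) refl q

      ∑q^odd² : ∑ M (λ l → q ^ (odd l ℕ.* odd l)) ≈ q * ψ (sq (sq (sq q)))
      ∑q^odd² = begin
        ∑ M f            ≈⟨ sym (∑-truncate M M (λ l M≤l → q^≥N _ (bound l M≤l))) ⟩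
        ∑ (M ℕ.+ M) f    ≡⟨ ≡.cong (λ n → ∑ n f) (≡.sym N≡M+M) ⟩
        ∑ N f            ≈⟨ ∑-cong N q^odd² ⟩
        ∑ N (λ l → q * Z (sq (sq (sq q))) (sq (sq (sq q))) l) ≈⟨ sym (*-∑ N q _) ⟩
        q * ψ (sq (sq (sq q))) ∎
        where
        f : ℕ → Carrier
        f l = q ^ (odd l ℕ.* odd l)
        bound : ∀ l → M ℕ.≤ l → N ℕ.≤ odd l ℕ.* odd l
        bound l M≤l = ℕ.≤-trans (ℕ.m≤n⇒m≤1+n (ℕ.*-monoˡ-≤ 2 M≤l)) (ℕ.m≤m+n (odd l) _)

      module _ (2-cancel : ∀ {a b} → a + a ≈ b + b → a ≈ b) where

        -- At (q, 1) the terms of charge r and -(r+1) coincide, so every term of ψ occurs twice.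
        θ-q1 : θ q q 1# ≈ ψ q + ψ q
        θ-q1 = begin
          1# + ∑ N (λ r → Z q q (suc r) + Z q 1# (suc r))
            ≈⟨ +-congˡ (∑-cong N (λ r → +-congˡ (Z-1 r))) ⟩
          1# + ∑ N (λ r → Z q q (suc r) + Z q q r)
            ≈⟨ +-congˡ (∑-distrib N _ _) ⟩
          1# + (∑ N (λ r → Z q q (suc r)) + ψ q)
            ≈⟨ sym (+-assoc _ _ _) ⟩
          ∑ (suc N) (Z q q) + ψ q
            ≈⟨ +-congʳ (trans (∑-last N (Z q q)) (trans (+-congˡ (Z-N N qN)) (+-identityʳ _))) ⟩
          ψ q + ψ q ∎
          where
          Z-1 : ∀ r → Z q 1# (suc r) ≈ Z q q r
          Z-1 r = trans (*-congʳ (*-identityˡ _)) (trans (sym (Z-scale q 1# r)) (Z-cong refl (*-identityʳ q) r))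
          Z-N : ∀ n → q ^ n ≈ 0# → Z q q n ≈ 0#
          Z-N zero    qⁿ = qⁿ
          Z-N (suc n) qⁿ = trans (*-congʳ qⁿ) (zeroˡ _)

        F-q1 : F q q 1# ≈ sq (poch q q N) + sq (poch q q N)
        F-q1 = begin
          D * poch q 1# N
            -- One further factor is harmless as q^N = 0; with it, splitting off the initial factor
            -- 1 + 1 leaves exactly `N` factors.
            ≈⟨ *-congˡ (sym (trans (reflexive (≡.cong (poch q 1#) (≡.sym (ℕ.+-comm N 1)))) (poch-stable 1# 1))) ⟩
          D * poch q 1# (suc N)
            ≈⟨ *-congˡ (*-cong (+-congˡ (*-identityˡ 1#)) (∏-cong N (λ j → +-congˡ (*-identityˡ _)))) ⟩
          D * ((1# + 1#) * D)
            ≈⟨ solve 1 (λ d → d :* ((con 1 :+ con 1) :* d) := d :* d :+ d :* d) refl D ⟩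
          sq D + sq D ∎
          where D = poch q q N

        -- Gauss's identity (-q; q)² = ψ(q)/(q; q): both sides of the triple product at (q, 1) are
        -- visibly doubled, which is why `2-cancel` is assumed.
        sq-D : sq (poch q q N) ≈ U q * ψ q
        sq-D = 2-cancel (begin
          sq (poch q q N) + sq (poch q q N)  ≈⟨ sym F-q1 ⟩
          F q q 1#                           ≈⟨ jacobiTripleProduct q 1# (*-identityʳ q) ⟩
          U q * θ q q 1#                     ≈⟨ *-congˡ θ-q1 ⟩
          U q * (ψ q + ψ q)                  ≈⟨ distribˡ _ _ _ ⟩
          U q * ψ q + U q * ψ q              ∎)

        U*D : U q * poch q q N ≋ 1# [ 2# ]
        U*D =
          U q * poch q q N                             ≈⟨ sym (∏-distrib N _ _) ⟩≋
          ∏ N (λ j → geom (q ^ suc j) * (1# + q ^ suc j)) ≋⟨ ≋-∏ N factor ⟩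
          ∏ N (λ _ → 1#)                               ≈⟨ ∏-1 N (λ _ → refl) ⟩≋
          1#                                           ≋∎
          where
          factor : ∀ j → geom (q ^ suc j) * (1# + q ^ suc j) ≋ 1# [ 2# ]
          factor j = w , (begin
            g * (1# + p)           ≈⟨ solve 2 (λ g p → g :* (con 1 :+ p) := g :+ p :* g) refl g p ⟩
            g + w                  ≈⟨ +-congʳ (geom-unfold ([q^suc]^N j)) ⟩
            1# + w + w             ≈⟨ solve 1 (λ w → con 1 :+ w :+ w := con 1 :+ (con 1 :+ con 1) :* w) refl w ⟩
            1# + 2# * w            ∎)
            where
            p = q ^ suc j
            g = geom p
            w = p * g

        -- With D = (-q; q), `sq-D` reads Uψ = D², hence U³ψ = (UD)². Modulo 2, D agrees with (q;
        -- q), the inverse of U.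
        ψ*U³ : ψ q * (U q * sq (U q)) ≋ 1# [ 2# ]
        ψ*U³ =
          ψ q * (U q * sq (U q))
            ≈⟨ solve 2 (λ s u → s :* (u :* (u :* u)) := u :* u :* (u :* s)) refl _ _ ⟩≋
          sq (U q) * (U q * ψ q)
            ≈⟨ trans (*-congˡ (sym sq-D)) (sym (sq-* _ _)) ⟩≋
          sq (U q * poch q q N)
            ≋⟨ ≋-* U*D U*D ⟩
          1# * 1#
            ≈⟨ *-identityˡ 1# ⟩≋
          1# ≋∎

-- Reduction of the eighteenth power modulo 8.

module EighteenthPower (R : CommutativeRing 0ℓ 0ℓ) where
  open CommutativeRing R
  open import Algebra.Properties.CommutativeSemiring.Exp commutativeSemiring
  open import Algebra.Solver.Ring.NaturalCoefficients.Default commutativeSemiring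
    using (solve; con; _:+_; _:*_; _:=_)
  open import Relation.Binary.Reasoning.Setoid setoid
  open BigOperators R
  open TripleProduct R
  open Congruence R
  open Theta R

  module Eighteen (M : ℕ) (x y : Carrier) where
    open HalfTruncated M
    -- `B` is the ninth power of `U₂`. Both `B` and `C` are built from q², x² and y² only, so their
    -- product has only even exponents.
    q θ₁ θ⁻ θ⁻₂ θ₄ U₂ A B C : Carrier
    q   = x * y
    θ₁  = θ q x y
    θ⁻  = θ (- q) x (- y) * θ (- q) (- x) y
    θ⁻₂ = θ (sq q) (- sq x) (- sq y)
    θ₄  = θ (sq (sq q)) (sq (sq x)) (sq (sq y))
    U₂  = U (sq q)
    A   = sq (U q) * sq (sq (sq U₂))
    B   = U₂ * sq (sq (sq U₂))
    C   = θ⁻₂ * sq (sq θ₄)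

    module _ (qN : q ^ N ≈ 0#) where

      ^18 : ∀ a → a ^ 18 ≈ sq a * sq (sq (sq (sq a)))
      ^18 a = begin
        a ^ 18                       ≈⟨ ^-homo-* a 2 16 ⟩
        a ^ 2 * a ^ 16               ≈⟨ *-cong (sym (sq-^2 a)) a^16 ⟩
        sq a * sq (sq (sq (sq a)))   ∎
        where
        sq-^2 : ∀ b → sq b ≈ b ^ 2
        sq-^2 b = *-congˡ (sym (*-identityʳ b))
        a^16 : a ^ 16 ≈ sq (sq (sq (sq a)))
        a^16 = begin
          a ^ 16                ≈⟨ ^-homo-* a 8 8 ⟩
          sq (a ^ 8)            ≈⟨ sq-cong (^-homo-* a 4 4) ⟩
          sq (sq (a ^ 4))       ≈⟨ sq-cong (sq-cong (^-homo-* a 2 2)) ⟩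
          sq (sq (sq (a ^ 2)))  ≈⟨ sq-cong (sq-cong (sq-cong (sym (sq-^2 a)))) ⟩
          sq (sq (sq (sq a)))   ∎

      -- 18 = 2 + 16, and the 16th powers are fourth powers of objects known modulo 2. The arguments
      -- of U are squared once and those of θ twice: the eighth power of `U₂` will be completed to
      -- the ninth power `B`, and `θ₄` has only charges divisible by 4.
      F^18 : F q x y ^ 18 ≋ A * sq (sq θ₄) * sq θ₁ [ 8# ]
      F^18 =
        F q x y ^ 18
          ≈⟨ ^-congˡ 18 (Nil.jacobiTripleProduct q qN x y refl) ⟩≋
        (U q * θ₁) ^ 18
          ≈⟨ trans (^18 _) (*-cong (sq-* _ _) sq⁴-*) ⟩≋
        sq (U q) * sq θ₁ * (sq (sq (sq (sq (U q)))) * sq (sq (sq (sq θ₁))))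
          ≋⟨ ≋-* ≋-refl (≋-* U^16 θ^16) ⟩
        sq (U q) * sq θ₁ * (sq (sq (sq U₂)) * sq (sq θ₄))
          ≈⟨ solve 4 (λ a b c d → a :* b :* (c :* d) := a :* c :* d :* b) refl _ _ _ _ ⟩≋
        A * sq (sq θ₄) * sq θ₁ ≋∎
        where
        sq⁴-* : sq (sq (sq (sq (U q * θ₁)))) ≈ sq (sq (sq (sq (U q)))) * sq (sq (sq (sq θ₁)))
        sq⁴-* = trans (sq-cong (sq-cong (sq-cong (sq-* _ _)))) (trans (sq-cong (sq-cong (sq-* _ _))) (trans (sq-cong (sq-* _ _)) (sq-* _ _)))
        U^16 : sq (sq (sq (sq (U q)))) ≋ sq (sq (sq U₂)) [ 8# ]
        U^16 = ≋-* eighth eighth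
          where
          eighth : sq (sq (sq (U q))) ≋ sq (sq U₂) [ 8# ]
          eighth = sq-4⇒8 (sq-2⇒4 (U-sq q))
        θ^4 : sq (sq θ₁) ≋ θ₄ [ 2# ]
        θ^4 = ≋-trans (≋-* (θ-sq q x y) (θ-sq q x y)) (θ-sq _ _ _)
        θ^16 : sq (sq (sq (sq θ₁))) ≋ sq (sq θ₄) [ 8# ]
        θ^16 = sq-4⇒8 (sq-2⇒4 θ^4)

      module _ (2-cancel : ∀ {a b} → a + a ≈ b + b → a ≈ b) where

        -- Modulo 2, ψ(q⁸) is the fourth power of `ψ₂`. Times the ninth power of `U₂` this is `ψ₂`
        -- times the cube of `ψ₂ * (U₂ * sq U₂)`, which is 1 by `ψ*U³` at q².
        ψ₈*B : ψ (sq (sq (sq q))) * B ≋ ψ (sq q) [ 2# ]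
        ψ₈*B =
          ψ (sq (sq (sq q))) * B
            ≋⟨ ≋-* (≋-sym (≋-trans (≋-* (ψ-sq (sq q)) (ψ-sq (sq q))) (ψ-sq _))) ≋-refl ⟩
          sq (sq ψ₂) * B
            ≈⟨ solve 2 (λ s u → let s2 = λ a → a :* a; w = s :* (u :* s2 u) in
                 s2 (s2 s) :* (u :* s2 (s2 (s2 u))) := s :* (w :* (w :* w))) refl ψ₂ U₂ ⟩≋
          ψ₂ * (w * (w * w))
            ≋⟨ ≋-* ≋-refl (≋-* w≋1 (≋-* w≋1 w≋1)) ⟩
          ψ₂ * (1# * (1# * 1#))
            ≈⟨ solve 1 (λ s → s :* (con 1 :* (con 1 :* con 1)) := s) refl ψ₂ ⟩≋
          ψ₂ ≋∎
          where
          ψ₂ = ψ (sq q)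
          w = ψ₂ * (U₂ * sq U₂)
          w≋1 : w ≋ 1# [ 2# ]
          w≋1 = ψ*U³ (sq q) (sq-nil qN) 2-cancel

        A*θ⁻ : A * sq (sq θ₄) * θ⁻ ≋ B * C + 4# * (q * ψ (sq q) * C) [ 8# ]
        A*θ⁻ =
          A * sq (sq θ₄) * θ⁻
            ≈⟨ *-congˡ (θ-neg-product q x y refl qN) ⟩≋
          A * sq (sq θ₄) * (sq (E (- q)) * (U₂ * θ⁻₂))
            ≈⟨ solve 6 (λ u b t e v s → u :* u :* b :* t :* (e :* e :* (v :* s)) := (u :* e) :* (u :* e) :* (v :* b :* (s :* t)))
                 refl (U q) (sq (sq (sq U₂))) (sq (sq θ₄)) (E (- q)) U₂ θ⁻₂ ⟩≋
          sq (U q * E (- q)) * (B * C)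
            ≋⟨ ≋-* (sq-U*E q qN) ≋-refl ⟩
          (1# + 4# * ∑q) * (B * C)
            ≈⟨ *-congʳ (+-congˡ (*-congˡ (∑q^odd² q qN))) ⟩≋
          (1# + 4# * (q * ψ₈)) * (B * C)
            ≈⟨ solve 5 (λ f q p b c → (con 1 :+ f :* (q :* p)) :* (b :* c) := b :* c :+ f :* (q :* (p :* b) :* c)) refl 4# q ψ₈ B C ⟩≋
          B * C + 4# * (q * (ψ₈ * B) * C)
            ≋⟨ ≋-+ ≋-refl (4*-≋ (≋-* (≋-* ≋-refl ψ₈*B) ≋-refl)) ⟩
          B * C + 4# * (q * ψ (sq q) * C) ≋∎
          where
          ψ₈ = ψ (sq (sq (sq q)))
          ∑q = ∑ M (λ l → q ^ (odd l ℕ.* odd l))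

-- Subrings, endomorphisms, and parity under the exchange of variables.

module Functionals (R : CommutativeRing 0ℓ 0ℓ) where
  open CommutativeRing R
  open import Algebra.Properties.CommutativeSemiring.Exp commutativeSemiring
  open import Algebra.Solver.Ring.NaturalCoefficients.Default commutativeSemiring
    using (solve; con; _:+_; _:*_; _:=_)
  open BigOperators R
  open TripleProduct R
  open Theta R

  -- A set of representatives closed under the operations; it need not respect _≈_.
  record Subring (S : Carrier → Set) : Set where
    field
      0∈ : S 0#
      1∈ : S 1#
      +∈ : ∀ {a b} → S a → S b → S (a + b)
      *∈ : ∀ {a b} → S a → S b → S (a * b)
      -∈ : ∀ {a} → S a → S (- a)

    sq∈ : ∀ {a} → S a → S (sq a)
    sq∈ a = *∈ a a

    ^∈ : ∀ {a} → S a → ∀ k → S (a ^ k)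
    ^∈ a zero    = 1∈
    ^∈ a (suc k) = *∈ a (^∈ a k)

    ∑∈ : ∀ n {f} → (∀ i → S (f i)) → S (∑ n f)
    ∑∈ zero    f = 0∈
    ∑∈ (suc n) f = +∈ (f 0) (∑∈ n (f ∘ suc))

    ∏∈ : ∀ n {f} → (∀ i → S (f i)) → S (∏ n f)
    ∏∈ zero    f = 1∈
    ∏∈ (suc n) f = *∈ (f 0) (∏∈ n (f ∘ suc))

    Z∈ : ∀ {q t} → S q → S t → ∀ k → S (Z q t k)
    Z∈ q t zero    = 1∈
    Z∈ q t (suc k) = *∈ (*∈ t (^∈ q k)) (Z∈ q t k)

    module _ (M : ℕ) where
      open HalfTruncated M

      U∈ : ∀ {q} → S q → S (U q)
      U∈ q = ∏∈ N (λ j → ∑∈ N (^∈ (^∈ q (suc j))))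

      θ∈ : ∀ {q x y} → S q → S x → S y → S (θ q x y)
      θ∈ q x y = +∈ 1∈ (∑∈ N (λ r → +∈ (Z∈ q x (suc r)) (Z∈ q y (suc r))))

  open RingMorphisms rawRing rawRing using (IsRingHomomorphism)

  module Homomorphism (φ : Carrier → Carrier) (φ-hom : IsRingHomomorphism φ) where
    open IsRingHomomorphism φ-hom public

    φ-^ : ∀ a k → φ (a ^ k) ≈ φ a ^ k
    φ-^ a zero    = 1#-homo
    φ-^ a (suc k) = trans (*-homo _ _) (*-congˡ (φ-^ a k))

    φ-∑ : ∀ n f → φ (∑ n f) ≈ ∑ n (φ ∘ f)
    φ-∑ zero    f = 0#-homo
    φ-∑ (suc n) f = trans (+-homo _ _) (+-congˡ (φ-∑ n (f ∘ suc)))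

    φ-sq : ∀ a {b} → φ a ≈ b → φ (sq a) ≈ sq b
    φ-sq a φa = trans (*-homo a a) (*-cong φa φa)

    φ-neg : ∀ a {b} → φ a ≈ b → φ (- a) ≈ - b
    φ-neg a φa = trans (-‿homo a) (-‿cong φa)

    module _ {q t q′ t′} (φq : φ q ≈ q′) (φt : φ t ≈ t′) where

      φ-Z : ∀ k → φ (Z q t k) ≈ Z q′ t′ k
      φ-Z zero    = 1#-homo
      φ-Z (suc k) = trans (*-homo _ _) (*-cong (trans (*-homo _ _) (*-cong φt (trans (φ-^ q k) (^-congˡ k φq)))) (φ-Z k))

    module _ (M : ℕ) where
      open HalfTruncated M

      φ-θ : ∀ {q x y q′ x′ y′} → φ q ≈ q′ → φ x ≈ x′ → φ y ≈ y′ → φ (θ q x y) ≈ θ q′ x′ y′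
      φ-θ φq φx φy = trans (+-homo _ _) (+-cong 1#-homo (trans (φ-∑ N _)
        (∑-cong N (λ r → trans (+-homo _ _) (+-cong (φ-Z φq φx (suc r)) (φ-Z φq φy (suc r)))))))

      φ-ψ : ∀ {q q′} → φ q ≈ q′ → φ (ψ q) ≈ ψ q′
      φ-ψ φq = trans (φ-∑ N _) (∑-cong N (φ-Z φq φq))

      θ-swap : ∀ q x y → θ q x y ≈ θ q y x
      θ-swap q x y = +-congˡ (∑-cong N (λ r → +-comm _ _))

      θ-fixed : ∀ {q x y} → φ q ≈ q → φ x ≈ y → φ y ≈ x → φ (θ q x y) ≈ θ q x y
      θ-fixed {q} {x} {y} φq φx φy = trans (φ-θ φq φx φy) (θ-swap q y x)

      module Parity
        (c : Carrier → ℤ) (c-cong : ∀ {a b} → a ≈ b → c a ≡ c b)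
        (c-+ : ∀ a b → c (a + b) ≡ c a ℤ.+ c b) (c-φ : ∀ a → c (φ a) ≡ c a) where

        -- The terms of charge r and -r contribute equally.
        θ-parity : ∀ {f q x y} → φ f ≈ f → φ q ≈ q → φ x ≈ y → φ y ≈ x →
                   ∃[ z ] c (f * θ q x y) ≡ c f ℤ.+ + 2 ℤ.* z
        θ-parity {f} {q} {x} {y} φf φq φx φy = c a , (begin
          c (f * θ q x y)                ≡⟨ c-cong expand ⟩
          c (f + (a + b))                ≡⟨ c-+ f (a + b) ⟩
          c f ℤ.+ c (a + b)              ≡⟨ ≡.cong (λ z → c f ℤ.+ z) (c-+ a b) ⟩
          c f ℤ.+ (c a ℤ.+ c b)          ≡⟨ ≡.cong (λ z → c f ℤ.+ (c a ℤ.+ z)) (≡.trans (c-cong (sym φa)) (c-φ a)) ⟩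
          c f ℤ.+ (c a ℤ.+ c a)          ≡⟨ ≡.cong (λ z → c f ℤ.+ z) (double (c a)) ⟩
          c f ℤ.+ + 2 ℤ.* c a            ∎)
          where
          open ≡.≡-Reasoning
          a = f * ∑ N (λ r → Z q x (suc r))
          b = f * ∑ N (λ r → Z q y (suc r))
          expand : f * θ q x y ≈ f + (a + b)
          expand = trans (*-congˡ (+-congˡ (∑-distrib N _ _)))
            (solve 3 (λ f u v → f :* (con 1 :+ (u :+ v)) := f :+ (f :* u :+ f :* v)) refl f _ _)
          φa : φ a ≈ b
          φa = trans (*-homo _ _) (*-cong φf (trans (φ-∑ N _) (∑-cong N (λ r → φ-Z φq φx (suc r)))))
          double : ∀ z → z ℤ.+ z ≡ + 2 ℤ.* z
          double = ℤ-Solver.+-*-Solver.solve 1 (λ z → z ⊕ z ⊜ κ (+ 2) ⊗ z) ≡.refl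
            where open ℤ-Solver.+-*-Solver using () renaming (con to κ; _:+_ to _⊕_; _:*_ to _⊗_; _:=_ to _⊜_)

-- From ring congruences to a coefficient divisible by 8.

module Divisibility (R : CommutativeRing 0ℓ 0ℓ) where
  open CommutativeRing R
  open import Algebra.Properties.CommutativeSemiring.Exp commutativeSemiring
  open import Algebra.Solver.Ring.NaturalCoefficients.Default commutativeSemiring
    using (solve; con; _:+_; _:*_; _:=_)
  open TripleProduct R
  open Congruence R
  open Theta R
  open EighteenthPower R
  open Functionals R
  open RingMorphisms rawRing rawRing using (IsRingHomomorphism)
  open ℤ-Solver.+-*-Solver using () renaming (solve to ℤ-solve; con to κ; _:+_ to _⊕_; _:*_ to _⊗_; _:=_ to _⊜_)

  module _
    (M : ℕ) (x y : Carrier) (xy-nilpotent : (x * y) ^ (M ℕ.* 2) ≈ 0#)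
    (2-cancel : ∀ {a b} → a + a ≈ b + b → a ≈ b)
    (c : Carrier → ℤ) (c-cong : ∀ {a b} → a ≈ b → c a ≡ c b)
    (c-+ : ∀ a b → c (a + b) ≡ c a ℤ.+ c b)
    (swap : Carrier → Carrier) (swap-hom : IsRingHomomorphism swap)
    (c-swap : ∀ a → c (swap a) ≡ c a) (swap-x : swap x ≈ y) (swap-y : swap y ≈ x)
    where
    open HalfTruncated M
    open Eighteen M x y
    open Homomorphism swap swap-hom
    open Parity M c c-cong c-+ c-swap

    c-2# : ∀ a → c (2# * a) ≡ + 2 ℤ.* c a
    c-2# a = ≡.trans (c-cong (solve 1 (λ a → (con 1 :+ con 1) :* a := a :+ a) refl a)) (≡.trans (c-+ a a)
      (ℤ-solve 1 (λ z → z ⊕ z ⊜ κ (+ 2) ⊗ z) ≡.refl (c a)))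

    c-4# : ∀ a → c (4# * a) ≡ + 4 ℤ.* c a
    c-4# a = ≡.trans (c-cong (*-assoc 2# 2# a)) (≡.trans (c-2# (2# * a)) (≡.trans (≡.cong (λ z → + 2 ℤ.* z) (c-2# a))
      (ℤ-solve 1 (λ z → κ (+ 2) ⊗ (κ (+ 2) ⊗ z) ⊜ κ (+ 4) ⊗ z) ≡.refl (c a))))

    c-8# : ∀ a → c (8# * a) ≡ + 8 ℤ.* c a
    c-8# a = ≡.trans (c-cong (*-assoc 2# 4# a)) (≡.trans (c-2# (4# * a)) (≡.trans (≡.cong (λ z → + 2 ℤ.* z) (c-4# a))
      (ℤ-solve 1 (λ z → κ (+ 2) ⊗ (κ (+ 4) ⊗ z) ⊜ κ (+ 8) ⊗ z) ≡.refl (c a))))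

    c-≋ : ∀ {a b} → a ≋ b [ 8# ] → ∃[ z ] c a ≡ c b ℤ.+ + 8 ℤ.* z
    c-≋ {a} {b} (h , a≈) = c h , ≡.trans (c-cong a≈) (≡.trans (c-+ b (8# * h)) (≡.cong (λ z → c b ℤ.+ z) (c-8# h)))

    swap-q : swap q ≈ q
    swap-q = trans (*-homo x y) (trans (*-cong swap-x swap-y) (*-comm y x))

    *-fixed : ∀ {a b} → swap a ≈ a → swap b ≈ b → swap (a * b) ≈ a * b
    *-fixed fa fb = trans (*-homo _ _) (*-cong fa fb)

    -- `θ-parity` removes the five theta factors of `C` one at a time; it applies each time because
    -- the product that remains is fixed by the exchange of x and y.
    odd-part-even : c (q * ψ (sq q)) ≡ 0ℤ → ∃[ z ] c (q * ψ (sq q) * C) ≡ + 2 ℤ.* z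
    odd-part-even cψ = z₀ ℤ.+ z₁ ℤ.+ z₂ ℤ.+ z₃ ℤ.+ z₄ , (begin
      c (f₀ * C)
        ≡⟨ c-cong (solve 3 (λ f s t → f :* (s :* (t :* t :* (t :* t))) := f :* s :* t :* t :* t :* t) refl f₀ θ⁻₂ θ₄) ⟩
      c f₅
        ≡⟨ ≡.trans e₄ (≡.cong (λ c → c ℤ.+ + 2 ℤ.* z₄) (≡.trans e₃ (≡.cong (λ c → c ℤ.+ + 2 ℤ.* z₃)
            (≡.trans e₂ (≡.cong (λ c → c ℤ.+ + 2 ℤ.* z₂) (≡.trans e₁ (≡.cong (λ c → c ℤ.+ + 2 ℤ.* z₁)
            (≡.trans e₀ (≡.cong (λ c → c ℤ.+ + 2 ℤ.* z₀) cψ))))))))) ⟩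
      0ℤ ℤ.+ + 2 ℤ.* z₀ ℤ.+ + 2 ℤ.* z₁ ℤ.+ + 2 ℤ.* z₂ ℤ.+ + 2 ℤ.* z₃ ℤ.+ + 2 ℤ.* z₄
        ≡⟨ ℤ-solve 5 (λ a b c d e → let t = κ (+ 2) in κ 0ℤ ⊕ t ⊗ a ⊕ t ⊗ b ⊕ t ⊗ c ⊕ t ⊗ d ⊕ t ⊗ e ⊜ t ⊗ (a ⊕ b ⊕ c ⊕ d ⊕ e))
             ≡.refl z₀ z₁ z₂ z₃ z₄ ⟩
      + 2 ℤ.* (z₀ ℤ.+ z₁ ℤ.+ z₂ ℤ.+ z₃ ℤ.+ z₄) ∎)
      where
      open ≡.≡-Reasoning
      q₂-fixed = φ-sq q swap-q
      q₄-fixed = φ-sq (sq q) q₂-fixed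
      -x² = φ-neg (sq x) (φ-sq x swap-x)
      -y² = φ-neg (sq y) (φ-sq y swap-y)
      x⁴ = φ-sq (sq x) (φ-sq x swap-x)
      y⁴ = φ-sq (sq y) (φ-sq y swap-y)
      θ⁻₂-fixed : swap θ⁻₂ ≈ θ⁻₂
      θ⁻₂-fixed = θ-fixed M q₂-fixed -x² -y²
      θ₄-fixed : swap θ₄ ≈ θ₄
      θ₄-fixed = θ-fixed M q₄-fixed x⁴ y⁴
      f₀ = q * ψ (sq q)
      f₁ = f₀ * θ⁻₂
      f₂ = f₁ * θ₄
      f₃ = f₂ * θ₄
      f₄ = f₃ * θ₄
      f₅ = f₄ * θ₄
      f₀-fixed : swap f₀ ≈ f₀
      f₀-fixed = *-fixed swap-q (φ-ψ M q₂-fixed)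
      f₁-fixed = *-fixed f₀-fixed θ⁻₂-fixed
      f₂-fixed = *-fixed f₁-fixed θ₄-fixed
      f₃-fixed = *-fixed f₂-fixed θ₄-fixed
      f₄-fixed = *-fixed f₃-fixed θ₄-fixed
      p₀ = θ-parity f₀-fixed q₂-fixed -x² -y²
      p₁ = θ-parity f₁-fixed q₄-fixed x⁴ y⁴
      p₂ = θ-parity f₂-fixed q₄-fixed x⁴ y⁴
      p₃ = θ-parity f₃-fixed q₄-fixed x⁴ y⁴
      p₄ = θ-parity f₄-fixed q₄-fixed x⁴ y⁴
      z₀ = proj₁ p₀ ; z₁ = proj₁ p₁ ; z₂ = proj₁ p₂ ; z₃ = proj₁ p₃ ; z₄ = proj₁ p₄
      e₀ = proj₂ p₀ ; e₁ = proj₂ p₁ ; e₂ = proj₂ p₂ ; e₃ = proj₂ p₃ ; e₄ = proj₂ p₄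

    -- The hypotheses isolate what depends on individual exponents. Two multiples of 8 come from the
    -- congruences, and the third is 4 times the even number of `odd-part-even`.
    8∣c[F^18] : c (A * sq (sq θ₄) * sq θ₁) ≡ c (A * sq (sq θ₄) * θ⁻) → c (B * C) ≡ 0ℤ → c (q * ψ (sq q)) ≡ 0ℤ →
                + 8 ℤ.∣ c (F q x y ^ 18)
    8∣c[F^18] c-sign c-even cψ = combine (c-≋ (F^18 xy-nilpotent)) (c-≋ (A*θ⁻ xy-nilpotent 2-cancel)) (odd-part-even cψ)
      where
      open ≡.≡-Reasoning
      combine : ∃[ z ] c (F q x y ^ 18) ≡ c (A * sq (sq θ₄) * sq θ₁) ℤ.+ + 8 ℤ.* z →
                ∃[ z ] c (A * sq (sq θ₄) * θ⁻) ≡ c (B * C + 4# * (q * ψ (sq q) * C)) ℤ.+ + 8 ℤ.* z →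
                ∃[ z ] c (q * ψ (sq q) * C) ≡ + 2 ℤ.* z →
                + 8 ℤ.∣ c (F q x y ^ 18)
      combine (z , e) (z′ , e′) (w , e″) = ℤ.divides (z ℤ.+ z′ ℤ.+ w) (begin
          c (F q x y ^ 18)
            ≡⟨ ≡.trans e (≡.cong (λ k → k ℤ.+ + 8 ℤ.* z) (≡.trans c-sign e′)) ⟩
          c (B * C + 4# * (q * ψ (sq q) * C)) ℤ.+ + 8 ℤ.* z′ ℤ.+ + 8 ℤ.* z
            ≡⟨ ≡.cong (λ k → k ℤ.+ + 8 ℤ.* z′ ℤ.+ + 8 ℤ.* z) (≡.trans (c-+ _ _) (≡.cong₂ ℤ._+_ c-even
                 (≡.trans (c-4# _) (≡.cong (λ k → + 4 ℤ.* k) e″)))) ⟩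
          0ℤ ℤ.+ + 4 ℤ.* (+ 2 ℤ.* w) ℤ.+ + 8 ℤ.* z′ ℤ.+ + 8 ℤ.* z
            ≡⟨ ℤ-solve 3 (λ z z′ w → κ 0ℤ ⊕ κ (+ 4) ⊗ (κ (+ 2) ⊗ w) ⊕ κ (+ 8) ⊗ z′ ⊕ κ (+ 8) ⊗ z ⊜ (z ⊕ z′ ⊕ w) ⊗ κ (+ 8)) ≡.refl z z′ w ⟩
          (z ℤ.+ z′ ℤ.+ w) ℤ.* + 8 ∎)

-- The ring of truncated polynomials in two variables.

module Polynomials where
  open ≡ using (refl; sym; trans; cong; cong₂)

  Exponent : Set
  Exponent = ℕ × ℕ

  infixl 6 _⊞_
  _⊞_ : Exponent → Exponent → Exponent
  (i , j) ⊞ (k , l) = i ℕ.+ k , j ℕ.+ l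

  ⊞-comm : ∀ d e → d ⊞ e ≡ e ⊞ d
  ⊞-comm (i , j) (k , l) = cong₂ _,_ (ℕ.+-comm i k) (ℕ.+-comm j l)

  ⊞-assoc : ∀ d e f → (d ⊞ e) ⊞ f ≡ d ⊞ (e ⊞ f)
  ⊞-assoc (i , j) (k , l) (m , n) = cong₂ _,_ (ℕ.+-assoc i k m) (ℕ.+-assoc j l n)

  degree : Exponent → ℕ
  degree (i , j) = i ℕ.+ j

  degree-⊞ : ∀ d e → degree e ℕ.≤ degree (d ⊞ e)
  degree-⊞ (i , j) (k , l) = ℕ.+-mono-≤ (ℕ.m≤n+m k i) (ℕ.m≤n+m l j)

  -- A formal sum of terms, neither sorted nor collected: no normal form is ever needed, and a
  -- restriction on exponents is a plain `All` over the list.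
  Poly : Set
  Poly = List (ℤ × Exponent)

  Test : Set
  Test = Exponent → ℤ

  ⟪_,_⟫ : Poly → Test → ℤ
  ⟪ []          , h ⟫ = 0ℤ
  ⟪ (c , e) ∷ f , h ⟫ = c ℤ.* h e ℤ.+ ⟪ f , h ⟫

  monomial : ℕ → ℕ → Poly
  monomial i j = (1ℤ , i , j) ∷ []

  scale : ℤ × Exponent → Poly → Poly
  scale (c , e) = map (λ (c′ , e′) → c ℤ.* c′ , e ⊞ e′)

  infixl 7 _·_
  _·_ : Poly → Poly → Poly
  []      · g = []
  (t ∷ f) · g = scale t g ++ f · g

  neg : Poly → Poly
  neg = map (λ (c , e) → ℤ.- c , e)

  ⟪⟫-cong-All : ∀ {h k} f → All (λ t → h (proj₂ t) ≡ k (proj₂ t)) f → ⟪ f , h ⟫ ≡ ⟪ f , k ⟫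
  ⟪⟫-cong-All []            []       = refl
  ⟪⟫-cong-All ((c , e) ∷ f) (p ∷ ps) = cong₂ ℤ._+_ (cong (c ℤ.*_) p) (⟪⟫-cong-All f ps)

  ⟪⟫-congʳ : ∀ f {h k} → (∀ e → h e ≡ k e) → ⟪ f , h ⟫ ≡ ⟪ f , k ⟫
  ⟪⟫-congʳ f h≡k = ⟪⟫-cong-All f (All.universal (λ t → h≡k (proj₂ t)) f)

  ⟪⟫-++ : ∀ f g h → ⟪ f ++ g , h ⟫ ≡ ⟪ f , h ⟫ ℤ.+ ⟪ g , h ⟫
  ⟪⟫-++ []            g h = sym (ℤ.+-identityˡ _)
  ⟪⟫-++ ((c , e) ∷ f) g h = trans (cong (λ z → c ℤ.* h e ℤ.+ z) (⟪⟫-++ f g h)) (sym (ℤ.+-assoc (c ℤ.* h e) _ _))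

  ⟪⟫-+ʳ : ∀ f h k → ⟪ f , (λ e → h e ℤ.+ k e) ⟫ ≡ ⟪ f , h ⟫ ℤ.+ ⟪ f , k ⟫
  ⟪⟫-+ʳ []            h k = refl
  ⟪⟫-+ʳ ((c , e) ∷ f) h k = trans (cong (λ z → c ℤ.* (h e ℤ.+ k e) ℤ.+ z) (⟪⟫-+ʳ f h k))
    (solve 5 (λ c a b s t → c :* (a :+ b) :+ (s :+ t) := (c :* a :+ s) :+ (c :* b :+ t)) refl c (h e) (k e) _ _)
    where open ℤ-Solver.+-*-Solver

  ⟪⟫-0ʳ : ∀ f → ⟪ f , (λ _ → 0ℤ) ⟫ ≡ 0ℤ
  ⟪⟫-0ʳ []            = refl
  ⟪⟫-0ʳ ((c , e) ∷ f) = cong₂ ℤ._+_ (ℤ.*-zeroʳ c) (⟪⟫-0ʳ f)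

  ⟪⟫-*ʳ : ∀ f c h → ⟪ f , (λ e → c ℤ.* h e) ⟫ ≡ c ℤ.* ⟪ f , h ⟫
  ⟪⟫-*ʳ []            c h = sym (ℤ.*-zeroʳ c)
  ⟪⟫-*ʳ ((d , e) ∷ f) c h = trans (cong (λ z → d ℤ.* (c ℤ.* h e) ℤ.+ z) (⟪⟫-*ʳ f c h))
    (solve 4 (λ c d a s → d :* (c :* a) :+ c :* s := c :* (d :* a :+ s)) refl c d (h e) _)
    where open ℤ-Solver.+-*-Solver

  ⟪⟫-neg : ∀ f h → ⟪ neg f , h ⟫ ≡ ℤ.- ⟪ f , h ⟫
  ⟪⟫-neg []            h = refl
  ⟪⟫-neg ((c , e) ∷ f) h = trans (cong₂ ℤ._+_ (sym (ℤ.neg-distribˡ-* c (h e))) (⟪⟫-neg f h)) (sym (ℤ.neg-distrib-+ (c ℤ.* h e) _))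

  ⟪⟫-scale : ∀ c e g h → ⟪ scale (c , e) g , h ⟫ ≡ c ℤ.* ⟪ g , (λ e′ → h (e ⊞ e′)) ⟫
  ⟪⟫-scale c e []             h = sym (ℤ.*-zeroʳ c)
  ⟪⟫-scale c e ((d , e′) ∷ g) h = trans (cong (λ z → c ℤ.* d ℤ.* h (e ⊞ e′) ℤ.+ z) (⟪⟫-scale c e g h))
    (solve 4 (λ c d a s → c :* d :* a :+ c :* s := c :* (d :* a :+ s)) refl c d (h (e ⊞ e′)) _)
    where open ℤ-Solver.+-*-Solver

  ⟪⟫-· : ∀ f g h → ⟪ f · g , h ⟫ ≡ ⟪ f , (λ e → ⟪ g , (λ e′ → h (e ⊞ e′)) ⟫) ⟫
  ⟪⟫-· []            g h = refl
  ⟪⟫-· ((c , e) ∷ f) g h = trans (⟪⟫-++ (scale (c , e) g) (f · g) h) (cong₂ ℤ._+_ (⟪⟫-scale c e g h) (⟪⟫-· f g h))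

  ⟪⟫-swap : ∀ f g (h : Exponent → Exponent → ℤ) →
    ⟪ f , (λ e → ⟪ g , h e ⟫) ⟫ ≡ ⟪ g , (λ e′ → ⟪ f , (λ e → h e e′) ⟫) ⟫
  ⟪⟫-swap []            g h = sym (⟪⟫-0ʳ g)
  ⟪⟫-swap ((c , e) ∷ f) g h = begin
    c ℤ.* ⟪ g , h e ⟫ ℤ.+ ⟪ f , (λ e → ⟪ g , h e ⟫) ⟫
      ≡⟨ cong₂ ℤ._+_ (sym (⟪⟫-*ʳ g c (h e))) (⟪⟫-swap f g h) ⟩
    ⟪ g , (λ e′ → c ℤ.* h e e′) ⟫ ℤ.+ ⟪ g , (λ e′ → ⟪ f , (λ e → h e e′) ⟫) ⟫
      ≡⟨ sym (⟪⟫-+ʳ g _ _) ⟩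
    ⟪ g , (λ e′ → ⟪ (c , e) ∷ f , (λ e → h e e′) ⟫) ⟫ ∎
    where open ≡.≡-Reasoning

  -- Polynomials modulo terms of total degree > D are compared through the functionals
  -- that ignore those terms: the pairing of a product is an iterated pairing, so the
  -- ring laws need no convolution.
  module Truncation (D : ℕ) where

    Vanishing : Test → Set
    Vanishing h = ∀ e → D ℕ.< degree e → h e ≡ 0ℤ

    infix 4 _≈_
    record _≈_ (f g : Poly) : Set where
      constructor mk≈
      field pairing : ∀ h → Vanishing h → ⟪ f , h ⟫ ≡ ⟪ g , h ⟫
    open _≈_ public

    shift : ∀ e {h} → Vanishing h → Vanishing (λ e′ → h (e ⊞ e′))
    shift e v e′ D< = v (e ⊞ e′) (ℕ.≤-trans D< (degree-⊞ e e′))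

    -- Adding exponents never lowers the degree, so pairing with one factor turns an admissible test
    -- for a product into an admissible test for the other factor.
    inner : ∀ g {h} → Vanishing h → Vanishing (λ e → ⟪ g , (λ e′ → h (e ⊞ e′)) ⟫)
    inner g {h} v e D< = trans (⟪⟫-congʳ g (λ e′ → trans (cong h (⊞-comm e e′)) (shift e′ v e D<))) (⟪⟫-0ʳ g)

    ++-cong : ∀ {f f′ g g′} → f ≈ f′ → g ≈ g′ → f ++ g ≈ f′ ++ g′
    ++-cong {f} {f′} {g} {g′} p r .pairing h v = trans (⟪⟫-++ f g h)
      (trans (cong₂ ℤ._+_ (pairing p h v) (pairing r h v)) (sym (⟪⟫-++ f′ g′ h)))

    ·-cong : ∀ {f f′ g g′} → f ≈ f′ → g ≈ g′ → f · g ≈ f′ · g′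
    ·-cong {f} {f′} {g} {g′} p r .pairing h v = begin
      ⟪ f · g , h ⟫                                 ≡⟨ ⟪⟫-· f g h ⟩
      ⟪ f , (λ e → ⟪ g , (λ e′ → h (e ⊞ e′)) ⟫) ⟫     ≡⟨ pairing p _ (inner g v) ⟩
      ⟪ f′ , (λ e → ⟪ g , (λ e′ → h (e ⊞ e′)) ⟫) ⟫    ≡⟨ ⟪⟫-congʳ f′ (λ e → pairing r _ (shift e v)) ⟩
      ⟪ f′ , (λ e → ⟪ g′ , (λ e′ → h (e ⊞ e′)) ⟫) ⟫   ≡⟨ ⟪⟫-· f′ g′ h ⟨
      ⟪ f′ · g′ , h ⟫                               ∎
      where open ≡.≡-Reasoning

    ·-assoc : ∀ f g k → (f · g) · k ≈ f · (g · k)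
    ·-assoc f g k .pairing h v = begin
      ⟪ (f · g) · k , h ⟫
        ≡⟨ ⟪⟫-· (f · g) k h ⟩
      ⟪ f · g , (λ e → ⟪ k , (λ e′ → h (e ⊞ e′)) ⟫) ⟫
        ≡⟨ ⟪⟫-· f g _ ⟩
      ⟪ f , (λ d → ⟪ g , (λ e → ⟪ k , (λ e′ → h (d ⊞ e ⊞ e′)) ⟫) ⟫) ⟫
        ≡⟨ ⟪⟫-congʳ f (λ d → ⟪⟫-congʳ g (λ e → ⟪⟫-congʳ k (λ e′ → cong h (⊞-assoc d e e′)))) ⟩
      ⟪ f , (λ d → ⟪ g , (λ e → ⟪ k , (λ e′ → h (d ⊞ (e ⊞ e′))) ⟫) ⟫) ⟫
        ≡⟨ ⟪⟫-congʳ f (λ d → ⟪⟫-· g k (λ e → h (d ⊞ e))) ⟨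
      ⟪ f , (λ d → ⟪ g · k , (λ e → h (d ⊞ e)) ⟫) ⟫
        ≡⟨ ⟪⟫-· f (g · k) h ⟨
      ⟪ f · (g · k) , h ⟫ ∎
      where open ≡.≡-Reasoning

    ·-comm : ∀ f g → f · g ≈ g · f
    ·-comm f g .pairing h v = begin
      ⟪ f · g , h ⟫                               ≡⟨ ⟪⟫-· f g h ⟩
      ⟪ f , (λ e → ⟪ g , (λ e′ → h (e ⊞ e′)) ⟫) ⟫   ≡⟨ ⟪⟫-swap f g _ ⟩
      ⟪ g , (λ e′ → ⟪ f , (λ e → h (e ⊞ e′)) ⟫) ⟫   ≡⟨ ⟪⟫-congʳ g (λ e′ → ⟪⟫-congʳ f (λ e → cong h (⊞-comm e e′))) ⟩
      ⟪ g , (λ e′ → ⟪ f , (λ e → h (e′ ⊞ e)) ⟫) ⟫   ≡⟨ ⟪⟫-· g f h ⟨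
      ⟪ g · f , h ⟫                               ∎
      where open ≡.≡-Reasoning

    ·-identityˡ : ∀ f → monomial 0 0 · f ≈ f
    ·-identityˡ f .pairing h v = trans (⟪⟫-· (monomial 0 0) f h) (trans (ℤ.+-identityʳ _) (ℤ.*-identityˡ _))

    ·-distribˡ : ∀ f g k → f · (g ++ k) ≈ f · g ++ f · k
    ·-distribˡ f g k .pairing h v = begin
      ⟪ f · (g ++ k) , h ⟫
        ≡⟨ ⟪⟫-· f (g ++ k) h ⟩
      ⟪ f , (λ e → ⟪ g ++ k , (λ e′ → h (e ⊞ e′)) ⟫) ⟫
        ≡⟨ ⟪⟫-congʳ f (λ e → ⟪⟫-++ g k _) ⟩
      ⟪ f , (λ e → ⟪ g , (λ e′ → h (e ⊞ e′)) ⟫ ℤ.+ ⟪ k , (λ e′ → h (e ⊞ e′)) ⟫) ⟫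
        ≡⟨ ⟪⟫-+ʳ f _ _ ⟩
      ⟪ f , (λ e → ⟪ g , (λ e′ → h (e ⊞ e′)) ⟫) ⟫ ℤ.+ ⟪ f , (λ e → ⟪ k , (λ e′ → h (e ⊞ e′)) ⟫) ⟫
        ≡⟨ cong₂ ℤ._+_ (⟪⟫-· f g h) (⟪⟫-· f k h) ⟨
      ⟪ f · g , h ⟫ ℤ.+ ⟪ f · k , h ⟫
        ≡⟨ ⟪⟫-++ (f · g) (f · k) h ⟨
      ⟪ f · g ++ f · k , h ⟫ ∎
      where open ≡.≡-Reasoning

    ≈-refl : ∀ {f} → f ≈ f
    ≈-refl .pairing h v = refl

    ≈-sym : ∀ {f g} → f ≈ g → g ≈ f
    ≈-sym p .pairing h v = sym (pairing p h v)

    ≈-trans : ∀ {f g k} → f ≈ g → g ≈ k → f ≈ k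
    ≈-trans p r .pairing h v = trans (pairing p h v) (pairing r h v)

    ++-comm : ∀ f g → f ++ g ≈ g ++ f
    ++-comm f g .pairing h v = trans (⟪⟫-++ f g h) (trans (ℤ.+-comm ⟪ f , h ⟫ _) (sym (⟪⟫-++ g f h)))

    ++-assoc : ∀ f g k → (f ++ g) ++ k ≈ f ++ (g ++ k)
    ++-assoc f g k .pairing h v = begin
      ⟪ (f ++ g) ++ k , h ⟫                     ≡⟨ trans (⟪⟫-++ (f ++ g) k h) (cong (λ z → z ℤ.+ _) (⟪⟫-++ f g h)) ⟩
      ⟪ f , h ⟫ ℤ.+ ⟪ g , h ⟫ ℤ.+ ⟪ k , h ⟫     ≡⟨ ℤ.+-assoc ⟪ f , h ⟫ _ _ ⟩
      ⟪ f , h ⟫ ℤ.+ (⟪ g , h ⟫ ℤ.+ ⟪ k , h ⟫)   ≡⟨ trans (⟪⟫-++ f (g ++ k) h) (cong (λ z → ⟪ f , h ⟫ ℤ.+ z) (⟪⟫-++ g k h)) ⟨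
      ⟪ f ++ (g ++ k) , h ⟫                     ∎
      where open ≡.≡-Reasoning

    neg-inverseʳ : ∀ f → f ++ neg f ≈ []
    neg-inverseʳ f .pairing h v = trans (⟪⟫-++ f (neg f) h) (trans (cong (λ z → ⟪ f , h ⟫ ℤ.+ z) (⟪⟫-neg f h)) (ℤ.+-inverseʳ ⟪ f , h ⟫))

    neg-cong : ∀ {f g} → f ≈ g → neg f ≈ neg g
    neg-cong {f} {g} p .pairing h v = trans (⟪⟫-neg f h) (trans (cong ℤ.-_ (pairing p h v)) (sym (⟪⟫-neg g h)))

    polyRing : CommutativeRing 0ℓ 0ℓ
    polyRing = record
      { Carrier = Poly ; _≈_ = _≈_ ; _+_ = _++_ ; _*_ = _·_ ; -_ = neg ; 0# = [] ; 1# = monomial 0 0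
      ; isCommutativeRing = record
        { isRing = record
          { +-isAbelianGroup = record
            { isGroup = record
              { isMonoid = record
                { isSemigroup = record
                  { isMagma = record
                    { isEquivalence = record { refl = ≈-refl ; sym = ≈-sym ; trans = ≈-trans }
                    ; ∙-cong = ++-cong }
                  ; assoc = ++-assoc }
                ; identity = (λ f → ≈-refl) , (λ f → ++-comm f []) }
              ; inverse = (λ f → ≈-trans (++-comm (neg f) f) (neg-inverseʳ f)) , neg-inverseʳ
              ; ⁻¹-cong = neg-cong }
            ; comm = ++-comm }
          ; *-cong = ·-cong
          ; *-assoc = ·-assoc
          ; *-identity = ·-identityˡ , (λ f → ≈-trans (·-comm f _) (·-identityˡ f))
          ; distrib = ·-distribˡ , (λ f g k → ≈-trans (·-comm (g ++ k) f)
              (≈-trans (·-distribˡ f g k) (++-cong (·-comm f g) (·-comm f k)))) }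
        ; *-comm = ·-comm } }

    -- Equality is tested in ℤ, which has no 2-torsion.
    2-cancel : ∀ {f g} → f ++ f ≈ g ++ g → f ≈ g
    2-cancel {f} {g} p .pairing h v = ℤ.*-cancelˡ-≡ (+ 2) _ _ (begin
      + 2 ℤ.* ⟪ f , h ⟫          ≡⟨ double ⟪ f , h ⟫ ⟩
      ⟪ f , h ⟫ ℤ.+ ⟪ f , h ⟫    ≡⟨ ⟪⟫-++ f f h ⟨
      ⟪ f ++ f , h ⟫             ≡⟨ pairing p h v ⟩
      ⟪ g ++ g , h ⟫             ≡⟨ ⟪⟫-++ g g h ⟩
      ⟪ g , h ⟫ ℤ.+ ⟪ g , h ⟫    ≡⟨ double ⟪ g , h ⟫ ⟨
      + 2 ℤ.* ⟪ g , h ⟫          ∎)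
      where
      open ≡.≡-Reasoning
      open ℤ-Solver.+-*-Solver
      double : ∀ a → + 2 ℤ.* a ≡ a ℤ.+ a
      double = solve 1 (λ a → con (+ 2) :* a := a :+ a) refl

-- The diagonal coefficient: supports, signs and symmetry.

module Coefficients where
  open ≡ using (refl; sym; trans; cong; cong₂; subst)
  open Polynomials

  indicator : {A : Set} → Dec A → ℤ
  indicator (yes _) = 1ℤ
  indicator (no _)  = 0ℤ

  δ : ℕ → Test
  δ n e = indicator (≡-dec ℕ._≟_ ℕ._≟_ e (n , n))

  δ-cases : ∀ n e (P : ℤ → Set) → P 0ℤ → (e ≡ (n , n) → P 1ℤ) → P (δ n e)
  δ-cases n e P p0 p1 with ≡-dec ℕ._≟_ ℕ._≟_ e (n , n)
  ... | yes e≡ = p1 e≡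
  ... | no _   = p0

  Supported : (Exponent → Set) → Poly → Set
  Supported P = All (P ∘ proj₂)

  Supported-· : ∀ {P Q R : Exponent → Set} → (∀ d e → P d → Q e → R (d ⊞ e)) →
                ∀ {f g} → Supported P f → Supported Q g → Supported R (f · g)
  Supported-· PQ⇒R []                         Qg = []
  Supported-· PQ⇒R {f = (c , d) ∷ f} (Pd ∷ Pf) Qg =
    All.++⁺ (All.map⁺ (All.map (λ {t} → PQ⇒R d (proj₂ t) Pd) Qg)) (Supported-· PQ⇒R Pf Qg)

  -- Covers x ↦ -x, y ↦ -y and the exchange of x and y at once: `χ` supplies the sign and `s` the
  -- new exponent.
  twist : (Exponent → ℤ) → (Exponent → Exponent) → Poly → Poly
  twist χ s = map (λ (c , e) → c ℤ.* χ e , s e)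

  ⟪⟫-twist : ∀ χ s f h → ⟪ twist χ s f , h ⟫ ≡ ⟪ f , (λ e → χ e ℤ.* h (s e)) ⟫
  ⟪⟫-twist χ s []            h = refl
  ⟪⟫-twist χ s ((c , e) ∷ f) h = cong₂ ℤ._+_ (ℤ.*-assoc c (χ e) _) (⟪⟫-twist χ s f h)

  sign : ℕ → ℤ
  sign zero    = 1ℤ
  sign (suc k) = ℤ.- sign k

  sign-+ : ∀ k l → sign (k ℕ.+ l) ≡ sign k ℤ.* sign l
  sign-+ zero    l = sym (ℤ.*-identityˡ _)
  sign-+ (suc k) l = trans (cong ℤ.-_ (sign-+ k l)) (ℤ.neg-distribˡ-* (sign k) (sign l))

  sign-even : ∀ {k} → 2 ℕ.∣ k → sign k ≡ 1ℤ
  sign-even (ℕ.divides k refl) = go k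
    where
    go : ∀ k → sign (k ℕ.* 2) ≡ 1ℤ
    go zero    = refl
    go (suc k) = trans (ℤ.neg-involutive _) (go k)

  -- The charge a - b is divisible by 4, phrased in ℕ without subtraction.
  Balanced : Exponent → Set
  Balanced (a , b) = ∃[ u ] ∃[ v ] a ℕ.+ 4 ℕ.* u ≡ b ℕ.+ 4 ℕ.* v

  -- The exponent of the theta term of charge k, doubled to avoid halves; k is an integer so that
  -- both signs are treated alike.
  Triangular : Exponent → Set
  Triangular (a , b) = ∃[ k ] (+ 2 ℤ.* + a ≡ k ℤ.* k ℤ.+ k) × (+ 2 ℤ.* + b ≡ k ℤ.* k ℤ.- k)

  -- With r and s the charges of two theta terms, so that r + s = 4 t, one has
  -- 2 (a₂ - b₁) = s² + s - r² + r = 4 t (s - r + 1).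
  even-sign : ∀ {e e₁ e₂ n} → Balanced e → Triangular e₁ → Triangular e₂ → e ⊞ (e₁ ⊞ e₂) ≡ (n , n) →
              2 ℕ.∣ proj₂ e₁ ℕ.+ proj₁ e₂
  even-sign {a , b} {a₁ , b₁} {a₂ , b₂} (u , v , bal) (r , 2a₁ , 2b₁) (s , 2a₂ , 2b₂) total =
    ℤ.∣⇒∣ᵤ (ℤ.divides (+ b₁ ℤ.+ t ℤ.* w) (trans (ℤ.*-cancelˡ-≡ (+ 2) _ _ main) (ℤ.*-comm (+ 2) _)))
    where
    open ≡.≡-Reasoning
    open ℤ-Solver.+-*-Solver
    t = + u ℤ.- + v
    w = s ℤ.- r ℤ.+ 1ℤ
    bal′ : + a ℤ.+ + 4 ℤ.* + u ≡ + b ℤ.+ + 4 ℤ.* + v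
    bal′ = trans (sym (trans (ℤ.pos-+ a _) (cong (λ z → + a ℤ.+ z) (ℤ.pos-* 4 u))))
      (trans (cong +_ bal) (trans (ℤ.pos-+ b _) (cong (λ z → + b ℤ.+ z) (ℤ.pos-* 4 v))))
    total′ : + a ℤ.+ (+ a₁ ℤ.+ + a₂) ≡ + b ℤ.+ (+ b₁ ℤ.+ + b₂)
    total′ = cong +_ (trans (cong proj₁ total) (sym (cong proj₂ total)))
    2[r+s] : + 2 ℤ.* (r ℤ.+ s) ≡ + 2 ℤ.* (+ 4 ℤ.* t)
    2[r+s] = begin
      + 2 ℤ.* (r ℤ.+ s)
        ≡⟨ solve 2 (λ r s → con (+ 2) :* (r :+ s) := (r :* r :+ r) :+ (s :* s :+ s) :- ((r :* r :- r) :+ (s :* s :- s))) refl r s ⟩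
      (r ℤ.* r ℤ.+ r) ℤ.+ (s ℤ.* s ℤ.+ s) ℤ.- ((r ℤ.* r ℤ.- r) ℤ.+ (s ℤ.* s ℤ.- s))
        ≡⟨ cong₂ ℤ._-_ (cong₂ ℤ._+_ 2a₁ 2a₂) (cong₂ ℤ._+_ 2b₁ 2b₂) ⟨
      (+ 2 ℤ.* + a₁ ℤ.+ + 2 ℤ.* + a₂) ℤ.- (+ 2 ℤ.* + b₁ ℤ.+ + 2 ℤ.* + b₂)
        ≡⟨ solve 5 (λ a a₁ a₂ b₁ b₂ → (con (+ 2) :* a₁ :+ con (+ 2) :* a₂) :- (con (+ 2) :* b₁ :+ con (+ 2) :* b₂)
             := con (+ 2) :* (a :+ (a₁ :+ a₂)) :- con (+ 2) :* (a :+ (b₁ :+ b₂))) refl (+ a) (+ a₁) (+ a₂) (+ b₁) (+ b₂) ⟩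
      + 2 ℤ.* (+ a ℤ.+ (+ a₁ ℤ.+ + a₂)) ℤ.- + 2 ℤ.* (+ a ℤ.+ (+ b₁ ℤ.+ + b₂))
        ≡⟨ cong (λ z → + 2 ℤ.* z ℤ.- + 2 ℤ.* (+ a ℤ.+ (+ b₁ ℤ.+ + b₂))) total′ ⟩
      + 2 ℤ.* (+ b ℤ.+ (+ b₁ ℤ.+ + b₂)) ℤ.- + 2 ℤ.* (+ a ℤ.+ (+ b₁ ℤ.+ + b₂))
        ≡⟨ solve 4 (λ a b p v → con (+ 2) :* (b :+ p) :- con (+ 2) :* (a :+ p)
             := con (+ 2) :* (b :+ con (+ 4) :* v) :- con (+ 2) :* (a :+ con (+ 4) :* v)) refl (+ a) (+ b) (+ b₁ ℤ.+ + b₂) (+ v) ⟩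
      + 2 ℤ.* (+ b ℤ.+ + 4 ℤ.* + v) ℤ.- + 2 ℤ.* (+ a ℤ.+ + 4 ℤ.* + v)
        ≡⟨ cong (λ z → + 2 ℤ.* z ℤ.- + 2 ℤ.* (+ a ℤ.+ + 4 ℤ.* + v)) bal′ ⟨
      + 2 ℤ.* (+ a ℤ.+ + 4 ℤ.* + u) ℤ.- + 2 ℤ.* (+ a ℤ.+ + 4 ℤ.* + v)
        ≡⟨ solve 3 (λ a u v → con (+ 2) :* (a :+ con (+ 4) :* u) :- con (+ 2) :* (a :+ con (+ 4) :* v)
             := con (+ 2) :* (con (+ 4) :* (u :- v))) refl (+ a) (+ u) (+ v) ⟩
      + 2 ℤ.* (+ 4 ℤ.* t) ∎
    r+s : r ℤ.+ s ≡ + 4 ℤ.* t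
    r+s = ℤ.*-cancelˡ-≡ (+ 2) _ _ 2[r+s]
    main : + 2 ℤ.* (+ b₁ ℤ.+ + a₂) ≡ + 2 ℤ.* (+ 2 ℤ.* (+ b₁ ℤ.+ t ℤ.* w))
    main = begin
      + 2 ℤ.* (+ b₁ ℤ.+ + a₂)
        ≡⟨ solve 2 (λ b a → con (+ 2) :* (b :+ a) := con (+ 4) :* b :- con (+ 2) :* b :+ con (+ 2) :* a) refl (+ b₁) (+ a₂) ⟩
      + 4 ℤ.* + b₁ ℤ.- + 2 ℤ.* + b₁ ℤ.+ + 2 ℤ.* + a₂
        ≡⟨ cong₂ (λ p q → + 4 ℤ.* + b₁ ℤ.- p ℤ.+ q) 2b₁ 2a₂ ⟩
      + 4 ℤ.* + b₁ ℤ.- (r ℤ.* r ℤ.- r) ℤ.+ (s ℤ.* s ℤ.+ s)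
        ≡⟨ solve 3 (λ b r s → con (+ 4) :* b :- (r :* r :- r) :+ (s :* s :+ s)
             := con (+ 4) :* b :+ (r :+ s) :* (s :- r :+ con 1ℤ)) refl (+ b₁) r s ⟩
      + 4 ℤ.* + b₁ ℤ.+ (r ℤ.+ s) ℤ.* w
        ≡⟨ cong (λ z → + 4 ℤ.* + b₁ ℤ.+ z ℤ.* w) r+s ⟩
      + 4 ℤ.* + b₁ ℤ.+ + 4 ℤ.* t ℤ.* w
        ≡⟨ solve 3 (λ b t w → con (+ 4) :* b :+ con (+ 4) :* t :* w := con (+ 2) :* (con (+ 2) :* (b :+ t :* w))) refl (+ b₁) t w ⟩
      + 2 ℤ.* (+ 2 ℤ.* (+ b₁ ℤ.+ t ℤ.* w)) ∎

  module Coefficient (n : ℕ) where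
    open Truncation (n ℕ.+ n) using (polyRing; pairing; mk≈; Vanishing; 2-cancel)
    open CommutativeRing polyRing
      using (_≈_; _+_; _*_; -_; 0#; rawRing; commutativeSemiring; *-cong; *-congˡ; reflexive)
      renaming (refl to ≈-refl; sym to ≈-sym)
    open import Algebra.Properties.CommutativeSemiring.Exp commutativeSemiring using (_^_)
    open RingMorphisms rawRing rawRing using (IsRingHomomorphism)
    open TripleProduct polyRing using (sq; Z)
    open Congruence polyRing
    open Theta polyRing using (module HalfTruncated)
    open EighteenthPower polyRing using (module Eighteen)
    open Functionals polyRing
    open Divisibility polyRing
    open Range (CommutativeRing.+-commutativeMonoid polyRing) using () renaming (⨁ to ∑)

    δ-vanishing : Vanishing (δ n)
    δ-vanishing e 2n< = δ-cases n e (_≡ 0ℤ) refl (λ e≡ → ⊥-elim (ℕ.<-irrefl (cong degree (sym e≡)) 2n<))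

    coef : Poly → ℤ
    coef f = ⟪ f , δ n ⟫

    coef-cong : ∀ {f g} → f ≈ g → coef f ≡ coef g
    coef-cong f≈g = pairing f≈g (δ n) δ-vanishing

    coef-+ : ∀ f g → coef (f + g) ≡ coef f ℤ.+ coef g
    coef-+ f g = ⟪⟫-++ f g (δ n)

    coef-0 : ∀ {P f} → Supported P f → (P (n , n) → ⊥) → coef f ≡ 0ℤ
    coef-0 {P} {f} Pf ¬P = trans (⟪⟫-cong-All f (All.map (λ {t} Pt → δ-cases n (proj₂ t) (_≡ 0ℤ) refl (λ e≡ → ⊥-elim (¬P (subst P e≡ Pt)))) Pf)) (⟪⟫-0ʳ f)

    -- Conditions under which `twist χ s` is an endomorphism of the truncated ring; `degree-s`
    -- ensures that discarded terms stay discarded.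
    record Character (χ : Exponent → ℤ) (s : Exponent → Exponent) : Set where
      field
        χ-0    : χ (0 , 0) ≡ 1ℤ
        χ-⊞    : ∀ d e → χ (d ⊞ e) ≡ χ d ℤ.* χ e
        s-0    : s (0 , 0) ≡ (0 , 0)
        s-⊞    : ∀ d e → s (d ⊞ e) ≡ s d ⊞ s e
        degree-s : ∀ e → degree (s e) ≡ degree e

    module _ {χ s} (char : Character χ s) where
      open Character char
      private φ = twist χ s

      φ-cong : ∀ {f g} → f ≈ g → φ f ≈ φ g
      φ-cong {f} {g} f≈g = mk≈ λ h v → trans (⟪⟫-twist χ s f h) (trans
        (pairing f≈g _ (λ e D< → trans (cong (χ e ℤ.*_) (v (s e) (subst (n ℕ.+ n ℕ.<_) (sym (degree-s e)) D<))) (ℤ.*-zeroʳ (χ e))))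
        (sym (⟪⟫-twist χ s g h)))

      φ-+ : ∀ f g → φ (f + g) ≈ φ f + φ g
      φ-+ f g = reflexive (map-++ _ f g)

      φ-* : ∀ f g → φ (f * g) ≈ φ f * φ g
      φ-* f g = mk≈ λ h v → begin
        ⟪ φ (f * g) , h ⟫
          ≡⟨ trans (⟪⟫-twist χ s (f · g) h) (⟪⟫-· f g _) ⟩
        ⟪ f , (λ d → ⟪ g , (λ e → χ (d ⊞ e) ℤ.* h (s (d ⊞ e))) ⟫) ⟫
          ≡⟨ ⟪⟫-congʳ f (λ d → ⟪⟫-congʳ g (λ e → trans (cong₂ (λ c e′ → c ℤ.* h e′) (χ-⊞ d e) (s-⊞ d e)) (ℤ.*-assoc (χ d) _ _))) ⟩
        ⟪ f , (λ d → ⟪ g , (λ e → χ d ℤ.* (χ e ℤ.* h (s d ⊞ s e))) ⟫) ⟫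
          ≡⟨ ⟪⟫-congʳ f (λ d → trans (⟪⟫-*ʳ g (χ d) _) (cong (χ d ℤ.*_) (sym (⟪⟫-twist χ s g _)))) ⟩
        ⟪ f , (λ d → χ d ℤ.* ⟪ φ g , (λ e → h (s d ⊞ e)) ⟫) ⟫
          ≡⟨ trans (⟪⟫-· (φ f) (φ g) h) (⟪⟫-twist χ s f _) ⟨
        ⟪ φ f * φ g , h ⟫ ∎
        where open ≡.≡-Reasoning

      φ-neg : ∀ f → φ (- f) ≈ - φ f
      φ-neg f = mk≈ λ h v → trans (⟪⟫-twist χ s (neg f) h) (trans (⟪⟫-neg f _)
        (trans (cong ℤ.-_ (sym (⟪⟫-twist χ s f h))) (sym (⟪⟫-neg (φ f) h))))

      twist-hom : IsRingHomomorphism φ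
      twist-hom = record
        { isSemiringHomomorphism = record
          { isNearSemiringHomomorphism = record
            { +-isMonoidHomomorphism = record
              { isMagmaHomomorphism = record { isRelHomomorphism = record { cong = φ-cong } ; homo = φ-+ }
              ; ε-homo = ≈-refl }
            ; *-homo = φ-* }
          ; 1#-homo = reflexive (cong₂ (λ c e → (c , e) ∷ []) (trans (ℤ.*-identityˡ _) χ-0) s-0) }
        ; -‿homo = φ-neg }

    supported-subring : ∀ {P : Exponent → Set} → P (0 , 0) → (∀ d e → P d → P e → P (d ⊞ e)) → Subring (Supported P)
    supported-subring P0 P⊞ = record
      { 0∈ = [] ; 1∈ = P0 ∷ [] ; +∈ = All.++⁺ ; *∈ = Supported-· P⊞ ; -∈ = All.map⁺ }

    ^-supported : ∀ {P : Exponent → Set} {Q : ℕ → Exponent → Set} → Q 0 (0 , 0) →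
                  (∀ k d e → P d → Q k e → Q (suc k) (d ⊞ e)) →
                  ∀ {f} → Supported P f → ∀ k → Supported (Q k) (f ^ k)
    ^-supported         Q0 Q-suc f∈ zero    = Q0 ∷ []
    ^-supported {P} {Q} Q0 Q-suc f∈ (suc k) = Supported-· {P} {Q k} {Q (suc k)} (Q-suc k) f∈ (^-supported {P} {Q} Q0 Q-suc f∈ k)

    Z-supported : ∀ {T : Exponent → Set} {Q P : ℕ → Exponent → Set} → P 0 (0 , 0) →
                  (∀ k c d e → T c → Q k d → P k e → P (suc k) (c ⊞ d ⊞ e)) →
                  ∀ {q t} → Supported T t → (∀ k → Supported (Q k) (q ^ k)) → ∀ k → Supported (P k) (Z q t k)
    Z-supported             P0 P-suc t∈ q∈ zero    = P0 ∷ []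
    Z-supported {T} {Q} {P} P0 P-suc {q} {t} t∈ q∈ (suc k) =
      Supported-· {λ d → ∃[ a ] ∃[ b ] T a × Q k b × d ≡ a ⊞ b} {P k} {P (suc k)}
        (λ { _ e (a , b , Ta , Qb , refl) Pe → P-suc k a b e Ta Qb Pe })
        (Supported-· {T} {Q k} (λ a b Ta Qb → a , b , Ta , Qb , refl) t∈ (q∈ k))
        (Z-supported {T} {Q} {P} P0 P-suc t∈ q∈ k)

    ∑-supported : ∀ {P : Exponent → Set} k {f : ℕ → Poly} → (∀ r → Supported P (f r)) → Supported P (∑ k f)
    ∑-supported zero    f∈ = []
    ∑-supported (suc k) f∈ = All.++⁺ (f∈ 0) (∑-supported k (f∈ ∘ suc))

    high-degree≈0 : ∀ {f} → Supported (λ e → n ℕ.+ n ℕ.< degree e) f → f ≈ 0#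
    high-degree≈0 {f} high = mk≈ λ h v → trans (⟪⟫-cong-All f (All.map (λ {t} → v (proj₂ t)) high)) (⟪⟫-0ʳ f)

    -- Gives N = 2n + 2, which exceeds n: the degree 2N of `q ^ N` lies beyond the truncation at 2n,
    -- and every entry of a partition of n is the index of one of the N factors.
    M : ℕ
    M = suc n

    x y : Poly
    x = monomial 1 0
    y = monomial 0 1

    open HalfTruncated M
    open Eighteen M x y

    q^-supported : ∀ k → Supported (_≡ (k , k)) (q ^ k)
    q^-supported = ^-supported {_≡ (1 , 1)} {λ k → _≡ (k , k)} refl (λ { _ _ _ refl refl → refl }) {q} (refl ∷ [])

    q-nilpotent : q ^ N ≈ 0#
    q-nilpotent = high-degree≈0 {q ^ N} (All.map (λ { {_ , _} refl → bound }) (q^-supported N))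
      where
      bound : n ℕ.+ n ℕ.< N ℕ.+ N
      bound = ℕ.+-mono-<-≤ n<N (ℕ.<⇒≤ n<N)
        where
        n<N : n ℕ.< N
        n<N = ℕ.s≤s (ℕ.m≤n⇒m≤1+n (ℕ.m≤m*n n 2))

    private
      χ₁ χ₂ : Exponent → ℤ
      χ₁ (i , j) = sign j
      χ₂ (i , j) = sign i

    x↦-x : Character χ₂ id
    x↦-x = record { χ-0 = refl ; χ-⊞ = λ (i , _) (k , _) → sign-+ i k ; s-0 = refl ; s-⊞ = λ _ _ → refl ; degree-s = λ _ → refl }

    y↦-y : Character χ₁ id
    y↦-y = record { χ-0 = refl ; χ-⊞ = λ (_ , j) (_ , l) → sign-+ j l ; s-0 = refl ; s-⊞ = λ _ _ → refl ; degree-s = λ _ → refl }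

    x↔y : Character (λ _ → 1ℤ) swap
    x↔y = record { χ-0 = refl ; χ-⊞ = λ _ _ → refl ; s-0 = refl ; s-⊞ = λ _ _ → refl ; degree-s = λ (i , j) → ℕ.+-comm j i }

    coef-swap : ∀ f → coef (twist (λ _ → 1ℤ) swap f) ≡ coef f
    coef-swap f = trans (⟪⟫-twist (λ _ → 1ℤ) swap f (δ n)) (⟪⟫-congʳ f λ e →
      trans (ℤ.*-identityˡ _) (δ-swap e))
      where
      δ-swap : ∀ e → δ n (swap e) ≡ δ n e
      δ-swap e with ≡-dec ℕ._≟_ ℕ._≟_ (swap e) (n , n) | ≡-dec ℕ._≟_ ℕ._≟_ e (n , n)
      ... | yes _    | yes _    = refl
      ... | no _     | no _     = refl
      ... | yes refl | no e≢    = ⊥-elim (e≢ refl)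
      ... | no e≢    | yes refl = ⊥-elim (e≢ refl)

    -- If the charges of two theta terms add up to a multiple of 4, the signs that they
    -- acquire in Θ(x,-y) and Θ(-x,y) cancel.
    coef-twists : ∀ {G f} → Supported Balanced G → Supported Triangular f →
                  coef (G * (f * f)) ≡ coef (G * (twist χ₁ id f * twist χ₂ id f))
    coef-twists {G} {f} G∈ f∈ = begin
      ⟪ G * (f * f) , δ n ⟫
        ≡⟨ ⟪⟫-·· G f f (δ n) ⟩
      ⟪ G , (λ e → ⟪ f , (λ e₁ → ⟪ f , (λ e₂ → δ n (e ⊞ (e₁ ⊞ e₂))) ⟫) ⟫) ⟫
        ≡⟨ ⟪⟫-cong-All G (All.map (λ {t} Ge → ⟪⟫-cong-All f (All.map (λ {t₁} T₁ → inner (proj₂ t) (proj₂ t₁) Ge T₁) f∈)) G∈) ⟩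
      ⟪ G , (λ e → ⟪ f , (λ e₁ → χ₁ e₁ ℤ.* ⟪ twist χ₂ id f , (λ e₂ → δ n (e ⊞ (e₁ ⊞ e₂))) ⟫) ⟫) ⟫
        ≡⟨ ⟪⟫-congʳ G (λ e → ⟪⟫-twist χ₁ id f (λ e₁ → ⟪ twist χ₂ id f , (λ e₂ → δ n (e ⊞ (e₁ ⊞ e₂))) ⟫)) ⟨
      ⟪ G , (λ e → ⟪ twist χ₁ id f , (λ e₁ → ⟪ twist χ₂ id f , (λ e₂ → δ n (e ⊞ (e₁ ⊞ e₂))) ⟫) ⟫) ⟫
        ≡⟨ ⟪⟫-·· G (twist χ₁ id f) (twist χ₂ id f) (δ n) ⟨
      ⟪ G * (twist χ₁ id f * twist χ₂ id f) , δ n ⟫ ∎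
      where
      open ≡.≡-Reasoning
      ⟪⟫-·· : ∀ f g k h → ⟪ f * (g * k) , h ⟫ ≡ ⟪ f , (λ d → ⟪ g , (λ e → ⟪ k , (λ e′ → h (d ⊞ (e ⊞ e′))) ⟫) ⟫) ⟫
      ⟪⟫-·· f g k h = trans (⟪⟫-· f (g * k) h) (⟪⟫-congʳ f (λ d → ⟪⟫-· g k (λ e → h (d ⊞ e))))
      term : ∀ e e₁ e₂ → Balanced e → Triangular e₁ → Triangular e₂ →
             δ n (e ⊞ (e₁ ⊞ e₂)) ≡ χ₁ e₁ ℤ.* (χ₂ e₂ ℤ.* δ n (e ⊞ (e₁ ⊞ e₂)))
      term e e₁ e₂ Be T₁ T₂ = δ-cases n (e ⊞ (e₁ ⊞ e₂)) (λ z → z ≡ χ₁ e₁ ℤ.* (χ₂ e₂ ℤ.* z))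
        (sym (trans (cong (χ₁ e₁ ℤ.*_) (ℤ.*-zeroʳ (χ₂ e₂))) (ℤ.*-zeroʳ (χ₁ e₁))))
        (λ total → sym (trans (cong (χ₁ e₁ ℤ.*_) (ℤ.*-identityʳ (χ₂ e₂)))
          (trans (sym (sign-+ (proj₂ e₁) (proj₁ e₂))) (sign-even (even-sign {e} {e₁} {e₂} Be T₁ T₂ total)))))
      inner : ∀ e e₁ → Balanced e → Triangular e₁ → ⟪ f , (λ e₂ → δ n (e ⊞ (e₁ ⊞ e₂))) ⟫ ≡
              χ₁ e₁ ℤ.* ⟪ twist χ₂ id f , (λ e₂ → δ n (e ⊞ (e₁ ⊞ e₂))) ⟫
      inner e e₁ Be T₁ = begin
        ⟪ f , (λ e₂ → δ n (e ⊞ (e₁ ⊞ e₂))) ⟫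
          ≡⟨ ⟪⟫-cong-All f (All.map (λ {t₂} T₂ → term e e₁ (proj₂ t₂) Be T₁ T₂) f∈) ⟩
        ⟪ f , (λ e₂ → χ₁ e₁ ℤ.* (χ₂ e₂ ℤ.* δ n (e ⊞ (e₁ ⊞ e₂)))) ⟫
          ≡⟨ ⟪⟫-*ʳ f (χ₁ e₁) (λ e₂ → χ₂ e₂ ℤ.* δ n (e ⊞ (e₁ ⊞ e₂))) ⟩
        χ₁ e₁ ℤ.* ⟪ f , (λ e₂ → χ₂ e₂ ℤ.* δ n (e ⊞ (e₁ ⊞ e₂))) ⟫
          ≡⟨ cong (χ₁ e₁ ℤ.*_) (⟪⟫-twist χ₂ id f (λ e₂ → δ n (e ⊞ (e₁ ⊞ e₂)))) ⟨
        χ₁ e₁ ℤ.* ⟪ twist χ₂ id f , (λ e₂ → δ n (e ⊞ (e₁ ⊞ e₂))) ⟫ ∎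

    θ⁻-twist : θ⁻ ≈ twist χ₁ id θ₁ * twist χ₂ id θ₁
    θ⁻-twist = ≈-sym (*-cong
      (Homomorphism.φ-θ (twist χ₁ id) (twist-hom y↦-y) M {q} {x} {y} ≈-refl ≈-refl ≈-refl)
      (Homomorphism.φ-θ (twist χ₂ id) (twist-hom x↦-x) M {q} {x} {y} ≈-refl ≈-refl ≈-refl))

    -- `Triangular` with charge k and with charge -k, indexed by a natural number as the recursion
    -- of `Z` requires.
    Triangle⁺ Triangle⁻ : ℕ → Exponent → Set
    Triangle⁺ k (a , b) = (+ 2 ℤ.* + a ≡ + k ℤ.* + k ℤ.+ + k) × (+ 2 ℤ.* + b ≡ + k ℤ.* + k ℤ.- + k)
    Triangle⁻ k (a , b) = Triangle⁺ k (b , a)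

    -- Passing from k to k + 1 multiplies by x q^k, of exponent (k + 1, k), and 2(k + 1) and 2k are
    -- the increments of k² + k and k² - k.
    θ₁-supported : Supported Triangular θ₁
    θ₁-supported = All.++⁺ ((+ 0 , refl , refl) ∷ []) (∑-supported N (λ r → All.++⁺ (positive (suc r)) (negative (suc r))))
      where
      open ℤ-Solver.+-*-Solver
      up : ∀ k a → + 2 ℤ.* + a ≡ + k ℤ.* + k ℤ.+ + k → + 2 ℤ.* + (suc k ℕ.+ a) ≡ + suc k ℤ.* + suc k ℤ.+ + suc k
      up k a p = trans (ℤ.*-distribˡ-+ (+ 2) (+ suc k) (+ a)) (trans (cong (λ z → + 2 ℤ.* + suc k ℤ.+ z) p)
        (solve 1 (λ k → con (+ 2) :* (con 1ℤ :+ k) :+ (k :* k :+ k) := (con 1ℤ :+ k) :* (con 1ℤ :+ k) :+ (con 1ℤ :+ k)) refl (+ k)))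
      down : ∀ k b → + 2 ℤ.* + b ≡ + k ℤ.* + k ℤ.- + k → + 2 ℤ.* + (k ℕ.+ b) ≡ + suc k ℤ.* + suc k ℤ.- + suc k
      down k b p = trans (ℤ.*-distribˡ-+ (+ 2) (+ k) (+ b)) (trans (cong (λ z → + 2 ℤ.* + k ℤ.+ z) p)
        (solve 1 (λ k → con (+ 2) :* k :+ (k :* k :- k) := (con 1ℤ :+ k) :* (con 1ℤ :+ k) :- (con 1ℤ :+ k)) refl (+ k)))
      reflect : ∀ k e → Triangle⁻ k e → Triangular e
      reflect k (a , b) (p , r) = ℤ.- + k
        , trans r (solve 1 (λ k → k :* k :- k := (:- k) :* (:- k) :+ (:- k)) refl (+ k))
        , trans p (solve 1 (λ k → k :* k :+ k := (:- k) :* (:- k) :- (:- k)) refl (+ k))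
      positive : ∀ k → Supported Triangular (Z q x k)
      positive k = All.map {P = Triangle⁺ k ∘ proj₂} (λ (p , r) → + k , p , r)
        (Z-supported {_≡ (1 , 0)} {λ k → _≡ (k , k)} {Triangle⁺} (refl , refl)
          (λ { k _ _ (a , b) refl refl (p , r) → up k a p , down k b r }) {q} {x} (refl ∷ []) q^-supported k)
      negative : ∀ k → Supported Triangular (Z q y k)
      negative k = All.map {P = Triangle⁻ k ∘ proj₂} (λ {t} → reflect k (proj₂ t))
        (Z-supported {_≡ (0 , 1)} {λ k → _≡ (k , k)} {Triangle⁻} (refl , refl)
          (λ { k _ _ (a , b) refl refl (p , r) → up k b p , down k a r }) {q} {y} (refl ∷ []) q^-supported k)

    balanced : Subring (Supported Balanced)
    balanced = supported-subring (0 , 0 , refl) (λ (a , b) (c , d) (u , v , p) (u′ , v′ , p′) →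
      u ℕ.+ u′ , v ℕ.+ v′ , trans (regroup a c u u′) (trans (cong₂ ℕ._+_ p p′) (sym (regroup b d v v′))))
      where
      open ℕ-Solver.+-*-Solver
      regroup : ∀ a c u u′ → a ℕ.+ c ℕ.+ 4 ℕ.* (u ℕ.+ u′) ≡ (a ℕ.+ 4 ℕ.* u) ℕ.+ (c ℕ.+ 4 ℕ.* u′)
      regroup = solve 4 (λ a c u u′ → a :+ c :+ con 4 :* (u :+ u′) := (a :+ con 4 :* u) :+ (c :+ con 4 :* u′)) refl

    -- q has charge 0, while x⁴ and y⁴ have charges 4 and -4.
    balanced-factor : Supported Balanced (A * sq (sq θ₄))
    balanced-factor = *∈ (*∈ (sq∈ (U∈ M q∈)) (sq∈ (sq∈ (sq∈ (U∈ M (sq∈ q∈)))))) (sq∈ (sq∈ (θ∈ M {sq (sq q)} {sq (sq x)} {sq (sq y)} (sq∈ (sq∈ q∈))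
      ((0 , 1 , refl) ∷ []) ((1 , 0 , refl) ∷ []))))
      where
      open Subring balanced
      q∈ : Supported Balanced q
      q∈ = (0 , 0 , refl) ∷ []

    coef-sign : coef (A * sq (sq θ₄) * sq θ₁) ≡ coef (A * sq (sq θ₄) * θ⁻)
    coef-sign = trans (coef-twists balanced-factor θ₁-supported)
      (coef-cong {G * (twist χ₁ id θ₁ * twist χ₂ id θ₁)} {G * θ⁻} (*-congˡ {G} (≈-sym θ⁻-twist)))
      where
      G = A * sq (sq θ₄)

    even-subring : Subring (Supported (λ e → 2 ℕ.∣ proj₁ e))
    even-subring = supported-subring (2 ℕ.∣0) (λ _ _ p r → ℕ.∣m∣n⇒∣m+n p r)

    coef-even : (2 ℕ.∣ n → ⊥) → coef (B * C) ≡ 0ℤ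
    coef-even 2∤n = coef-0 {λ e → 2 ℕ.∣ proj₁ e} {B * C} (*∈ (*∈ U₂∈ (sq∈ (sq∈ (sq∈ U₂∈)))) (*∈ (θ∈ M {sq q} { - sq x} { - sq y} q²∈ x²∈ y²∈)
      (sq∈ (sq∈ (θ∈ M {sq (sq q)} {sq (sq x)} {sq (sq y)} (sq∈ q²∈) (ℕ.divides 2 refl ∷ []) (ℕ.divides 0 refl ∷ [])))))) 2∤n
      where
      open Subring even-subring
      q²∈ : Supported (λ e → 2 ℕ.∣ proj₁ e) (sq q)
      q²∈ = ℕ.divides 1 refl ∷ []
      x²∈ : Supported (λ e → 2 ℕ.∣ proj₁ e) (- sq x)
      x²∈ = ℕ.divides 1 refl ∷ []
      y²∈ : Supported (λ e → 2 ℕ.∣ proj₁ e) (- sq y)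
      y²∈ = ℕ.divides 0 refl ∷ []
      U₂∈ : Supported (λ e → 2 ℕ.∣ proj₁ e) U₂
      U₂∈ = U∈ M q²∈

    coef-ψ : (∀ k → suc (k ℕ.* suc k) ≡ n → ⊥) → coef (q * ψ (sq q)) ≡ 0ℤ
    coef-ψ n≢ = coef-0 {λ e → ∃[ k ] suc (k ℕ.* suc k) ≡ proj₁ e} {q * ψ (sq q)}
      (Supported-· {_≡ (1 , 1)} {λ e → ∃[ k ] k ℕ.* suc k ≡ proj₁ e} (λ { _ _ refl (k , refl) → k , refl }) {q} {ψ (sq q)} (refl ∷ [])
        (∑-supported N (λ k → All.map {P = λ t → k ℕ.* suc k ≡ proj₁ (proj₂ t)} (k ,_) (pronic k))))
      (λ (k , eq) → n≢ k eq)
      where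
      open ℕ-Solver.+-*-Solver
      pronic : ∀ k → Supported (λ e → k ℕ.* suc k ≡ proj₁ e) (Z (sq q) (sq q) k)
      pronic = Z-supported {_≡ (2 , 2)} {λ k e → proj₁ e ≡ k ℕ.* 2} {λ k e → k ℕ.* suc k ≡ proj₁ e} refl
        (λ { k _ _ _ refl refl refl → solve 1 (λ k → (con 1 :+ k) :* (con 2 :+ k) := con 2 :+ k :* con 2 :+ k :* (con 1 :+ k)) refl k })
        {sq q} {sq q} (refl ∷ [])
        (^-supported {_≡ (2 , 2)} {λ k e → proj₁ e ≡ k ℕ.* 2} refl (λ { _ _ _ refl refl → refl }) {sq q} (refl ∷ []))

    8∣coef[F^18] : (2 ℕ.∣ n → ⊥) → (∀ k → suc (k ℕ.* suc k) ≡ n → ⊥) → + 8 ℤ.∣ coef (F q x y ^ 18)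
    8∣coef[F^18] 2∤n n≢ = 8∣c[F^18] M x y q-nilpotent 2-cancel coef coef-cong coef-+ (twist (λ _ → 1ℤ) swap) (twist-hom x↔y)
      coef-swap ≈-refl ≈-refl coef-sign (coef-even 2∤n) (coef-ψ n≢)

  pronic-mod-3 : ∀ k → (k ℕ.* suc k) ℕ.% 3 ≡ 1 → ⊥
  pronic-mod-3 0 ()
  pronic-mod-3 1 ()
  pronic-mod-3 2 ()
  -- (k + 3)(k + 4) = k(k + 1) + 3(2k + 4), so the three cases above decide.
  pronic-mod-3 (suc (suc (suc k))) eq = pronic-mod-3 k (trans (sym (ℕ.[m+kn]%n≡m%n (k ℕ.* suc k) (2 ℕ.* k ℕ.+ 4) 3))
    (trans (cong (ℕ._% 3) (solve 1 (λ k → k :* (con 1 :+ k) :+ (con 2 :* k :+ con 4) :* con 3 := (con 3 :+ k) :* (con 4 :+ k)) refl k)) eq))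
    where open ℕ-Solver.+-*-Solver

  6m+5-odd : ∀ m → 2 ℕ.∣ 6 ℕ.* m ℕ.+ 5 → ⊥
  6m+5-odd m 2∣ = ℕ.>⇒∤ (ℕ.s≤s (ℕ.s≤s ℕ.z≤n)) (ℕ.∣m+n∣m⇒∣n (subst (2 ℕ.∣_) (regroup m) 2∣) (ℕ.m∣m*n (3 ℕ.* m ℕ.+ 2)))
    where
    open ℕ-Solver.+-*-Solver
    regroup : ∀ m → 6 ℕ.* m ℕ.+ 5 ≡ 2 ℕ.* (3 ℕ.* m ℕ.+ 2) ℕ.+ 1
    regroup = solve 1 (λ m → con 6 :* m :+ con 5 := con 2 :* (con 3 :* m :+ con 2) :+ con 1) refl

  6m+5-not-pronic : ∀ m k → suc (k ℕ.* suc k) ≡ 6 ℕ.* m ℕ.+ 5 → ⊥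
  6m+5-not-pronic m k eq = pronic-mod-3 k (trans (cong (ℕ._% 3) (ℕ.suc-injective (trans eq (regroup m)))) (ℕ.[m+kn]%n≡m%n 4 (2 ℕ.* m) 3))
    where
    open ℕ-Solver.+-*-Solver
    regroup : ∀ m → 6 ℕ.* m ℕ.+ 5 ≡ suc (4 ℕ.+ (2 ℕ.* m) ℕ.* 3)
    regroup = solve 1 (λ m → con 6 :* m :+ con 5 := con 1 :+ (con 4 :+ con 2 :* m :* con 3)) refl

-- Frobenius partitions as the terms of the expanded product.

module Counting where
  open ≡ using (refl; sym; trans; cong; cong₂; subst)
  open Polynomials
  open Coefficients

  ≻-trans : ∀ {k} {a b c : Colored k} → a ≻ b → b ≻ c → a ≻ c
  ≻-trans (inj₁ a>b)          (inj₁ b>c)          = inj₁ (ℕ.<-trans b>c a>b)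
  ≻-trans (inj₁ a>b)          (inj₂ (refl , _))   = inj₁ a>b
  ≻-trans (inj₂ (refl , _))   (inj₁ b>c)          = inj₁ b>c
  ≻-trans (inj₂ (refl , i>j)) (inj₂ (refl , j>l)) = inj₂ (refl , ℕ.<-trans j>l i>j)

  ≻-irrefl : ∀ {k} {a : Colored k} → a ≻ a → ⊥
  ≻-irrefl (inj₁ a>a)       = ℕ.<-irrefl refl a>a
  ≻-irrefl (inj₂ (_ , i>i)) = ℕ.<-irrefl refl i>i

  module _ {A : Set} where

    -- Choosing 1 or the letter in every factor of a product yields a sublist, and over a strictly
    -- decreasing alphabet the sublists are exactly the strictly decreasing words in it. This links
    -- the expansion to rows.
    sublists : List A → List (List A)
    sublists []       = [] ∷ []
    sublists (a ∷ as) = sublists as ++ map (a ∷_) (sublists as)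

    ∈-sublists⁻ : ∀ as {r} → r ∈ sublists as → All (_∈ as) r
    ∈-sublists⁻ []       (here refl) = []
    ∈-sublists⁻ (a ∷ as) r∈ with ∈-++⁻ (sublists as) r∈
    ... | inj₁ r∈′ = All.map there (∈-sublists⁻ as r∈′)
    ... | inj₂ r∈′ with ∈-map⁻ (a ∷_) r∈′
    ...   | _ , s∈ , refl = here refl ∷ All.map there (∈-sublists⁻ as s∈)

    module _ {_≻′_ : A → A → Set} where

      sublists-sorted : ∀ {as} → AllPairs _≻′_ as → ∀ {r} → r ∈ sublists as → AllPairs _≻′_ r
      sublists-sorted []                 (here refl) = []
      sublists-sorted {a ∷ as} (a≻ ∷ as≻) r∈ with ∈-++⁻ (sublists as) r∈
      ... | inj₁ r∈′ = sublists-sorted as≻ r∈′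
      ... | inj₂ r∈′ with ∈-map⁻ (a ∷_) r∈′
      ...   | _ , s∈ , refl = All.map (All.lookup a≻) (∈-sublists⁻ as s∈) ∷ sublists-sorted as≻ s∈

      module _ (trans′ : ∀ {a b c} → a ≻′ b → b ≻′ c → a ≻′ c) (irrefl′ : ∀ {a} → a ≻′ a → ⊥) where

        []∈-sublists : ∀ as → [] ∈ sublists as
        []∈-sublists []       = here refl
        []∈-sublists (a ∷ as) = ∈-++⁺ˡ ([]∈-sublists as)

        drop-head : ∀ {a as b} → b ∈ a ∷ as → a ≻′ b → b ∈ as
        drop-head (here refl) a≻a = ⊥-elim (irrefl′ a≻a)
        drop-head (there b∈)  _   = b∈

        -- If r starts with the head a of the alphabet, irreflexivity keeps a out of the rest of r.
        -- Otherwise r starts with some b below a, and by transitivity a exceeds all of r and cannot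
        -- occur in it.
        ∈-sublists⁺ : ∀ {as} → AllPairs _≻′_ as → ∀ {r} → AllPairs _≻′_ r → All (_∈ as) r → r ∈ sublists as
        ∈-sublists⁺ {as} _ [] [] = []∈-sublists as
        ∈-sublists⁺ {a ∷ as} (a≻ ∷ as≻) (b≻ ∷ r≻) (here refl ∷ r∈) =
          ∈-++⁺ʳ (sublists as) (∈-map⁺ (a ∷_) (∈-sublists⁺ as≻ r≻ (All.zipWith (λ (c∈ , a≻c) → drop-head c∈ a≻c) (r∈ , b≻))))
        ∈-sublists⁺ {a ∷ as} (a≻ ∷ as≻) (b≻ ∷ r≻) (there b∈ ∷ r∈) =
          ∈-++⁺ˡ (∈-sublists⁺ as≻ (b≻ ∷ r≻) (b∈ ∷ All.zipWith (λ (c∈ , b≻c) → drop-head c∈ (trans′ (All.lookup a≻ b∈) b≻c)) (r∈ , b≻)))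

        sublists-unique : ∀ {as} → AllPairs _≻′_ as → Unique (sublists as)
        sublists-unique []                    = [] ∷ []
        sublists-unique {a ∷ as} (a≻ ∷ as≻) =
          Unique.++⁺ (sublists-unique as≻) (Unique.map⁺ ∷-injectiveʳ (sublists-unique as≻)) disjoint
          where
          disjoint : ∀ {r} → r ∈ sublists as × r ∈ map (a ∷_) (sublists as) → ⊥
          disjoint (r∈ , r∈′) with ∈-map⁻ (a ∷_) r∈′
          ... | _ , _ , refl with ∈-sublists⁻ as r∈
          ...   | a∈ ∷ _ = irrefl′ (All.lookup a≻ a∈)

  module _ (k : ℕ) where

    -- `opposite` lists the colors from the largest to the smallest, since the alphabet has to
    -- decrease as rows do.
    level : ℕ → List (Colored k)
    level j = map (j ,_) (tabulate opposite)

    alphabet : ℕ → List (Colored k)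
    alphabet zero    = []
    alphabet (suc N) = level N ++ alphabet N

    ∈-alphabet⁺ : ∀ {N j} i → j ℕ.< N → (j , i) ∈ alphabet N
    ∈-alphabet⁺ {suc N} {j} i (ℕ.s≤s j≤N) with ℕ.m≤n⇒m<n∨m≡n j≤N
    ... | inj₁ j<N  = ∈-++⁺ʳ (level N) (∈-alphabet⁺ i j<N)
    ... | inj₂ refl = ∈-++⁺ˡ (∈-map⁺ (j ,_) (subst (_∈ tabulate opposite) (Fin.opposite-involutive i) (∈-tabulate⁺ (opposite i))))

    alphabet-bound : ∀ N → All (λ c → proj₁ c ℕ.< N) (alphabet N)
    alphabet-bound zero    = []
    alphabet-bound (suc N) = All.++⁺ (All.map⁺ (All.universal (λ _ → ℕ.≤-refl) _)) (All.map ℕ.m≤n⇒m≤1+n (alphabet-bound N))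

    alphabet-sorted : ∀ N → AllPairs _≻_ (alphabet N)
    alphabet-sorted zero    = []
    alphabet-sorted (suc N) = AllPairs.++⁺
      (AllPairs.map⁺ (AllPairs.map (λ i>j → inj₂ (refl , i>j)) (AllPairs.tabulate⁺-< (λ {i} → opposite-antitone {i = i}))))
      (alphabet-sorted N)
      (All.map⁺ (All.universal (λ _ → All.map inj₁ (alphabet-bound N)) _))
      where
      opposite-antitone : ∀ {n} {i j : Fin n} → i Fin.< j → opposite i Fin.> opposite j
      opposite-antitone {n} {i} {j} i<j = ℕ.≤-trans
        (ℕ.≤-reflexive (cong suc (Fin.opposite-prop j)))
        (ℕ.≤-trans (ℕ.∸-monoʳ-< (ℕ.s≤s i<j) (Fin.toℕ<n j)) (ℕ.≤-reflexive (sym (Fin.opposite-prop i))))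

    rows : ℕ → List (Row k)
    rows N = sublists (alphabet N)

    ∈-rows⁺ : ∀ {N r} → Linked _≻_ r → rowSum r ℕ.< N → r ∈ rows N
    ∈-rows⁺ {N} {r} r≻ s = ∈-sublists⁺ ≻-trans ≻-irrefl (alphabet-sorted N) (Linked⇒AllPairs ≻-trans r≻) (entries r s)
      where
      entries : ∀ r → rowSum r ℕ.< N → All (_∈ alphabet N) r
      entries []            _ = []
      entries ((j , i) ∷ r) s = ∈-alphabet⁺ i (ℕ.≤-<-trans (ℕ.m≤m+n j _) s) ∷ entries r (ℕ.≤-<-trans (ℕ.m≤n+m _ j) s)

    ∈-rows⁻ : ∀ {N r} → r ∈ rows N → Linked _≻_ r
    ∈-rows⁻ {N} r∈ = AllPairs⇒Linked (sublists-sorted (alphabet-sorted N) r∈)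

    -- An entry j contributes x q^j = x^(j+1) y^j in the top row and y q^j in the bottom row. In the
    -- total of an array, the coordinates are equal precisely when the rows have the same length,
    -- and their common value is the number partitioned.
    topWeight bottomWeight : Row k → Exponent
    topWeight    r = length r ℕ.+ rowSum r , rowSum r
    bottomWeight r = rowSum r , length r ℕ.+ rowSum r

    arrayWeight : Array k → Exponent
    arrayWeight (a , b) = topWeight a ⊞ bottomWeight b

    module _ (n : ℕ) where

      weight≟ : ∀ ab → Dec (arrayWeight ab ≡ (n , n))
      weight≟ ab = ≡-dec ℕ._≟_ ℕ._≟_ (arrayWeight ab) (n , n)

      arrays : ℕ → List (Array k)
      arrays N = filter weight≟ (cartesianProduct (rows N) (rows N))

      weight⇒ : ∀ {a b} → Linked _≻_ a → Linked _≻_ b → arrayWeight (a , b) ≡ (n , n) → IsFrobeniusPartition k n (a , b)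
      weight⇒ {a} {b} a≻ b≻ w = mkIsFrobeniusPartition a≻ b≻ lengths
        (trans (sym (cong proj₁ w)) (ℕ.+-assoc (length a) _ _))
        where
        lengths : length a ≡ length b
        lengths = ℕ.+-cancelʳ-≡ (rowSum a ℕ.+ rowSum b) _ _ (begin
          length a ℕ.+ (rowSum a ℕ.+ rowSum b)  ≡⟨ ℕ.+-assoc (length a) _ _ ⟨
          length a ℕ.+ rowSum a ℕ.+ rowSum b    ≡⟨ trans (cong proj₁ w) (sym (cong proj₂ w)) ⟩
          rowSum a ℕ.+ (length b ℕ.+ rowSum b)  ≡⟨ solve 3 (λ s l t → s :+ (l :+ t) := l :+ (s :+ t)) refl (rowSum a) (length b) (rowSum b) ⟩
          length b ℕ.+ (rowSum a ℕ.+ rowSum b)  ∎)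
          where
          open ≡.≡-Reasoning
          open ℕ-Solver.+-*-Solver

      weight⇐ : ∀ {a b} → IsFrobeniusPartition k n (a , b) → arrayWeight (a , b) ≡ (n , n)
      weight⇐ {a} {b} (mkIsFrobeniusPartition _ _ l w) = cong₂ _,_
        (trans (ℕ.+-assoc (length a) _ _) (sym w))
        (trans (solve 3 (λ s l t → s :+ (l :+ t) := l :+ (s :+ t)) refl (rowSum a) (length b) (rowSum b))
          (trans (cong (ℕ._+ (rowSum a ℕ.+ rowSum b)) (sym l)) (sym w)))
        where open ℕ-Solver.+-*-Solver

      -- Both lists are free of repetitions and have the same members, so they are permutations of
      -- each other.
      ∣arrays∣ : ∀ {N} → n ℕ.< N → length (arrays N) ≡ cφ k n
      ∣arrays∣ {N} n<N = ↭-length (∼bag⇒↭ (unique∧set⇒bag arrays-unique (frobeniusPartitions-unique k n) (λ {ab} → mk⇔ (to ab) (from ab))))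
        where
        rows-unique : Unique (rows N)
        rows-unique = sublists-unique ≻-trans ≻-irrefl (alphabet-sorted N)
        arrays-unique : Unique (arrays N)
        arrays-unique = Unique.filter⁺ weight≟ (Unique.cartesianProduct⁺ rows-unique rows-unique)
        to : ∀ ab → ab ∈ arrays N → ab ∈ frobeniusPartitions k n
        to ab ab∈ with ∈-filter⁻ weight≟ {xs = cartesianProduct (rows N) (rows N)} ab∈
        ... | ab∈′ , w with ∈-cartesianProduct⁻ (rows N) (rows N) ab∈′
        ...   | a∈ , b∈ = Equivalence.from (∈-frobeniusPartitions k n ab) (weight⇒ (∈-rows⁻ {N} a∈) (∈-rows⁻ {N} b∈) w)
        from : ∀ ab → ab ∈ frobeniusPartitions k n → ab ∈ arrays N
        from ab@(a , b) ab∈ with Equivalence.to (∈-frobeniusPartitions k n ab) ab∈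
        ... | p@(mkIsFrobeniusPartition a≻ b≻ _ w) = ∈-filter⁺ weight≟
          (∈-cartesianProduct⁺ (∈-rows⁺ a≻ (bound (rowSum a) (ℕ.m≤m+n _ _))) (∈-rows⁺ b≻ (bound (rowSum b) (ℕ.m≤n+m _ (rowSum a)))))
          (weight⇐ p)
          where
          bound : ∀ s → s ℕ.≤ rowSum a ℕ.+ rowSum b → s ℕ.< N
          bound s s≤ = ℕ.≤-<-trans (ℕ.≤-trans s≤ (ℕ.≤-trans (ℕ.m≤n+m _ (length a)) (ℕ.≤-reflexive (sym w)))) n<N

  generating : {A : Set} → (A → Exponent) → List A → Poly
  generating w = map (λ a → 1ℤ , w a)

  -- A literal equality of lists: `_·_` and `cartesianProduct` enumerate the pairs in the same
  -- order.
  generating-× : ∀ {A B : Set} (v : A → Exponent) (w : B → Exponent) as bs →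
                 generating v as · generating w bs ≡ generating (λ (a , b) → v a ⊞ w b) (cartesianProduct as bs)
  generating-× v w []       bs = refl
  generating-× v w (a ∷ as) bs = trans
    (cong₂ _++_ (trans (sym (map-∘ bs)) (map-∘ bs)) (generating-× v w as bs))
    (sym (map-++ _ (map (a ,_) bs) (cartesianProduct as bs)))

  ⟪generating,δ⟫ : ∀ {A : Set} (w : A → Exponent) n as →
    ⟪ generating w as , δ n ⟫ ≡ + length (filter (λ a → ≡-dec ℕ._≟_ ℕ._≟_ (w a) (n , n)) as)
  ⟪generating,δ⟫ w n []       = refl
  ⟪generating,δ⟫ w n (a ∷ as) with ≡-dec ℕ._≟_ ℕ._≟_ (w a) (n , n) | ⟪generating,δ⟫ w n as
  ... | yes _ | ih = cong (λ z → 1ℤ ℤ.+ z) ih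
  ... | no _  | ih = trans (ℤ.+-identityˡ _) ih

  module Product (n : ℕ) where
    open Truncation (n ℕ.+ n) using (polyRing)
    open CommutativeRing polyRing
      using ( _≈_; _+_; _*_; 1#; commutativeSemiring; *-commutativeMonoid; setoid; +-cong; +-congˡ
            ; *-cong; *-congˡ; *-identityˡ; *-assoc; *-comm; distribʳ; reflexive )
      renaming (refl to ≈-refl; sym to ≈-sym; trans to ≈-trans)
    open import Algebra.Properties.CommutativeSemiring.Exp commutativeSemiring using (_^_; ^-congˡ; ^-distrib-*)
    module ≈-Reasoning = Relation.Binary.Reasoning.Setoid setoid
    open Range *-commutativeMonoid using () renaming (⨁-last to ∏-last)
    open TripleProduct polyRing using (poch)

    module _ {A : Set} (v : A → Exponent) (w : List A → Exponent) (w-[] : w [] ≡ (0 , 0)) (w-∷ : ∀ a r → w (a ∷ r) ≡ v a ⊞ w r) where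

      factors : List A → Poly
      factors []       = 1#
      factors (a ∷ as) = (1# + generating v (a ∷ [])) * factors as

      -- In the factor of the letter a, the summand 1 accounts for the sublists without a, the other
      -- summand for those with a.
      generating-sublists : ∀ as → generating w (sublists as) ≈ factors as
      generating-sublists []       = reflexive (cong (λ e → (1ℤ , e) ∷ []) w-[])
      generating-sublists (a ∷ as) = begin
        generating w (sublists as ++ map (a ∷_) (sublists as))
          ≡⟨ map-++ _ (sublists as) (map (a ∷_) (sublists as)) ⟩
        generating w (sublists as) + generating w (map (a ∷_) (sublists as))
          ≡⟨ cong (λ f → generating w (sublists as) + f) (head (sublists as)) ⟩
        generating w (sublists as) + m * generating w (sublists as)
          ≈⟨ ≈-sym (≈-trans (distribʳ g 1# m) (+-cong {1# * g} {g} {m * g} {m * g} (*-identityˡ g) ≈-refl)) ⟩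
        (1# + m) * generating w (sublists as)
          ≈⟨ *-congˡ {1# + m} (generating-sublists as) ⟩
        (1# + m) * factors as ∎
        where
        open ≈-Reasoning
        m = generating v (a ∷ [])
        g = generating w (sublists as)
        head : ∀ rs → generating w (map (a ∷_) rs) ≡ m * generating w rs
        head []       = refl
        head (r ∷ rs) = cong₂ (λ e f → (1ℤ , e) ∷ f) (w-∷ a r) (head rs)

      factors-++ : ∀ as bs → factors (as ++ bs) ≈ factors as * factors bs
      factors-++ []       bs = ≈-sym (*-identityˡ (factors bs))
      factors-++ (a ∷ as) bs = ≈-trans (*-congˡ {1# + generating v (a ∷ [])} (factors-++ as bs)) (≈-sym (*-assoc (1# + generating v (a ∷ [])) (factors as) (factors bs)))

    module _ (k : ℕ) (v : ℕ → Exponent) (w : Row k → Exponent) (w-[] : w [] ≡ (0 , 0)) (w-∷ : ∀ c r → w (c ∷ r) ≡ v (proj₁ c) ⊞ w r)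
             (q t : Poly) (v-power : ∀ j → t * q ^ j ≈ generating v (j ∷ [])) where
      private
        factors′ : List (Colored k) → Poly
        factors′ = factors (v ∘ proj₁) w w-[] w-∷

      factors-level : ∀ j cs → factors′ (map (j ,_) cs) ≈ (1# + t * q ^ j) ^ length cs
      factors-level j []       = ≈-refl
      factors-level j (i ∷ cs) = *-cong (+-congˡ {1#} (≈-sym (v-power j))) (factors-level j cs)

      -- Every level contributes k equal factors, one for each color.
      factors-alphabet : ∀ N → factors′ (alphabet k N) ≈ poch q t N ^ k
      factors-alphabet zero    = ≈-sym (1^ k)
        where
        1^ : ∀ k → 1# ^ k ≈ 1#
        1^ zero    = ≈-refl
        1^ (suc k) = ≈-trans (*-identityˡ (1# ^ k)) (1^ k)
      factors-alphabet (suc N) = begin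
        factors′ (level k N ++ alphabet k N)            ≈⟨ factors-++ (v ∘ proj₁) w w-[] w-∷ (level k N) (alphabet k N) ⟩
        factors′ (level k N) * factors′ (alphabet k N)  ≈⟨ *-cong (factors-level N (tabulate opposite)) (factors-alphabet N) ⟩
        f ^ length (tabulate {n = k} opposite) * poch q t N ^ k  ≡⟨ cong (λ l → f ^ l * poch q t N ^ k) (length-tabulate {n = k} opposite) ⟩
        f ^ k * poch q t N ^ k                          ≈⟨ ^-distrib-* f (poch q t N) k ⟨
        (f * poch q t N) ^ k                            ≈⟨ ^-congˡ k (≈-trans (*-comm f (poch q t N)) (≈-sym (∏-last N (λ j → 1# + t * q ^ j)))) ⟩
        poch q t (suc N) ^ k                            ∎
        where
        open ≈-Reasoning
        f = 1# + t * q ^ N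

      generating-rows : ∀ N → generating w (rows k N) ≈ poch q t N ^ k
      generating-rows N = ≈-trans (generating-sublists (v ∘ proj₁) w w-[] w-∷ (alphabet k N)) (factors-alphabet N)

    open Coefficient n
    open Theta.HalfTruncated polyRing M using (N; F)
    open EighteenthPower.Eighteen polyRing M x y using (q)

    q^-monomial : ∀ j → q ^ j ≈ monomial j j
    q^-monomial zero    = ≈-refl
    q^-monomial (suc j) = *-congˡ {q} (q^-monomial j)

    coef-F^ : ∀ k → coef (F q x y ^ k) ≡ + cφ k n
    coef-F^ k = begin
      coef (F q x y ^ k)
        ≡⟨ coef-cong {F q x y ^ k} {generating (topWeight k) (rows k N) * generating (bottomWeight k) (rows k N)} product ⟩
      coef (generating (topWeight k) (rows k N) * generating (bottomWeight k) (rows k N))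
        ≡⟨ cong coef (generating-× (topWeight k) (bottomWeight k) (rows k N) (rows k N)) ⟩
      coef (generating (arrayWeight k) (cartesianProduct (rows k N) (rows k N)))
        ≡⟨ ⟪generating,δ⟫ (arrayWeight k) n (cartesianProduct (rows k N) (rows k N)) ⟩
      + length (arrays k n N)
        ≡⟨ cong +_ (∣arrays∣ k n (ℕ.s≤s (ℕ.m≤n⇒m≤1+n (ℕ.m≤m*n n 2)))) ⟩
      + cφ k n ∎
      where
      open ≡.≡-Reasoning
      open ℕ-Solver.+-*-Solver using (solve; _:+_; _:=_)
      top : generating (topWeight k) (rows k N) ≈ poch q x N ^ k
      top = generating-rows k (λ j → suc j , j) (topWeight k) refl
        (λ (j , _) r → cong (_, (j ℕ.+ rowSum r)) (cong suc (solve 3 (λ l j s → l :+ (j :+ s) := j :+ (l :+ s)) refl (length r) j (rowSum r))))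
        q x (λ j → *-congˡ {x} (q^-monomial j)) N
      bottom : generating (bottomWeight k) (rows k N) ≈ poch q y N ^ k
      bottom = generating-rows k (λ j → j , suc j) (bottomWeight k) refl
        (λ (j , _) r → cong ((j ℕ.+ rowSum r) ,_) (cong suc (solve 3 (λ l j s → l :+ (j :+ s) := j :+ (l :+ s)) refl (length r) j (rowSum r))))
        q y (λ j → *-congˡ {y} (q^-monomial j)) N
      product : F q x y ^ k ≈ generating (topWeight k) (rows k N) * generating (bottomWeight k) (rows k N)
      product = ≈-trans (^-distrib-* (poch q x N) (poch q y N) k) (≈-sym (*-cong top bottom))

open import Data.Nat.Base using (_+_; _*_)
open import Data.Nat.Divisibility using (_∣_)

theorem1p2 : (n : ℕ) → 8 ∣ cφ 18 (6 * n + 5)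
theorem1p2 n = ℤ.∣⇒∣ᵤ (≡.subst (+ 8 ℤ.∣_) (coef-F^ 18) (8∣coef[F^18] (6m+5-odd n) (6m+5-not-pronic n)))
  where
  open Coefficients using (module Coefficient; 6m+5-odd; 6m+5-not-pronic)
  open Coefficient (6 * n + 5) using (8∣coef[F^18])
  open Counting.Product (6 * n + 5) using (coef-F^)
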